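{- Let $N\ge 16$ be an integer, and write $N=3k+i$ with $k\in\mathbb{N}$ and $i\in\{0,1,2\}$. Let $P^N_*$ denote the maximal number of finite paths $|FP(E)|$ over all connected acyclic directed graphs $E$ with exactly $N$ edges. Then $$P^N_*=\begin{cases}\frac14\left(121\cdot 3^{k-2}-2k+7\right) & \text{if } i=0,\\[2pt] \frac14\left(529\cdot 3^{k-3}-2k+25\right) & \text{if } i=1,\\[2pt] \frac14\left(253\cdot 3^{k-2}-2k+15\right) & \text{if } i=2.\end{cases}$$
   Context: A directed graph $E=(E^0,E^1,s_E,t_E)$ consists of a set of vertices $E^0$, a set of edges $E^1$, and source and target maps $s_E,t_E\colon E^1\to E^0$ (multiple edges are allowed). A finite path of length $n\ge1$ is a tuple $(e_1,\dots,e_n)$ of edges with $t_E(e_i)=s_E(e_{i+1})$ for $1\le i<n$; vertices are paths of length $0$. $FP(E)$ is the set of all finite paths in $E$ (including those of length $0$). $E$ is acyclic if it has no path of positive length whose beginning and end coincide. $E$ is connected if any two vertices are joined by a finite undirected path. -}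

module Defs where

open import Data.Nat using (ℕ; _≤_; _^_; _∸_)
open import Data.Integer using (ℤ; +_; _+_; _-_; _*_)
open import Data.Rational using (ℚ; _/_)
open import Data.Fin using (Fin)
open import Data.Fin.Patterns using (0F; 1F; 2F)
open import Data.List.NonEmpty using (List⁺; head; last; toList)
open import Data.List.Relation.Unary.Linked using (Linked)
open import Data.Product using (Σ; Σ-syntax; ∃-syntax; _×_; proj₁)
open import Data.Sum using (_⊎_)
open import Function.Bundles using (_↔_; _↣_)
open import Relation.Binary.Construct.Closure.Equivalence using (EqClosure)
open import Relation.Binary.PropositionalEquality using (_≡_; _≢_)

record Digraph : Set₁ where
  field
    E⁰  : Set
    E¹  : Set
    s t : E¹ → E⁰

module _ (E : Digraph) where
  open Digraph E

  PositivePath : Set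
  PositivePath = Σ[ es ∈ List⁺ E¹ ] Linked (λ e f → t e ≡ s f) (toList es)

  -- The left summand consists of the paths of length 0.
  FP : Set
  FP = E⁰ ⊎ PositivePath

  Acyclic : Set
  Acyclic = (p : PositivePath) → s (head (proj₁ p)) ≢ t (last (proj₁ p))

  Adjacent : E⁰ → E⁰ → Set
  Adjacent u v = ∃[ e ] (s e ≡ u × t e ≡ v)

  -- A derivation of EqClosure Adjacent u v is an undirected path: a finite,
  -- possibly empty chain of edges, each traversed in either direction.
  Connected : Set
  Connected = ∀ u v → EqClosure Adjacent u v

  HasEdgeCount : ℕ → Set
  HasEdgeCount N = E¹ ↔ Fin N

-- P is the maximum of |FP(E)| over all connected acyclic E with N edges.
-- The bound |FP(E)| ≤ P is expressed by saying that no more than P distinct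
-- paths can be listed, so that it also asserts the finiteness of FP(E)
-- instead of being restricted to those E for which FP(E) is finite.
record IsMaximalPathCount (N P : ℕ) : Set₁ where
  field
    attained : Σ[ E ∈ Digraph ]
               (Connected E × Acyclic E × HasEdgeCount E N × (FP E ↔ Fin P))
    bound    : ∀ E → Connected E → Acyclic E → HasEdgeCount E N →
               ∀ n → (Fin n ↣ FP E) → n ≤ P

-- The truncated subtractions in the exponents are only used for k ≥ 5,
-- as 3 k + i ≥ 16; all other arithmetic takes place in ℤ and ℚ.
pathCountFormula : ℕ → Fin 3 → ℚ
pathCountFormula k 0F = (+ 121 * + (3 ^ (k ∸ 2)) - + 2 * + k + + 7)  / 4
pathCountFormula k 1F = (+ 529 * + (3 ^ (k ∸ 3)) - + 2 * + k + + 25) / 4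
pathCountFormula k 2F = (+ 253 * + (3 ^ (k ∸ 2)) - + 2 * + k + + 15) / 4

{-# OPTIONS --safe #-}
module Submission where

-- A chain with d₁, …, dᵣ parallel edges between consecutive vertices has tot paths, where tot is computed from
-- the numbers top of paths starting at a given vertex by x ↦ 1 + d x. Chains are optimal: process the vertices of
-- a connected acyclic graph from the sinks upwards, and let v be the next vertex. If its edges meet c ≥ 1
-- components of the part already processed, then the number of paths starting at v is at most 1 + δ times the sum
-- of the maxima over these components, where δ = outdegree - (c - 1), so that v may be replaced by a vertex with
-- δ edges to the top of one chain. A sink starts a new component and becomes a vertex with δ = 1. Connectedness
-- says that components are merged one time less than there are vertices, so the δ's of all vertices but the first
-- add up to N.
--
-- For chains, entries d ≥ 4 may be split into 2 and d - 2. Reading a chain from its source, the remaining part ds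
-- contributes tot ds + α top ds, where α is the number of nontrivial paths from above to the junction. As soon as
-- α ≥ 10, the optimal rest is independent of α and consists of threes up to a bounded end; this leaves a finite
-- search over the initial entries. Inserting a three turns every number of paths x, with increment δ, into x + δ,
-- with increment 3 δ + 1, so the search is needed for three consecutive values of N only.

open import Defs
open import Data.Nat using (ℕ; _+_; _*_; _≥_)
open import Data.Integer using (+_)
open import Data.Rational using (_/_)
open import Data.Fin using (Fin; toℕ)
open import Data.Product using (∃-syntax; _×_)
open import Relation.Binary.PropositionalEquality using (_≡_)

open import Data.Bool using (true; false; if_then_else_) renaming (T to True)
open import Data.Empty using (⊥)
open import Data.Fin using (zero; suc)
open import Data.Fin.Patterns using (0F; 1F; 2F)
open import Data.Fin.Properties using (+↔⊎; *↔×; 1↔⊤; 0↔⊥; suc-injective; injective⇒≤; pigeonhole)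
import Data.Integer as ℤ
import Data.Integer.Properties as ℤ
open import Data.List using (List; []; _∷_; _++_; concatMap; filter; initLast; _∷ʳ′_; length; lookup; map; replicate; tabulate)
open import Data.List.Membership.Propositional using (_∈_; _∉_; find; lose)
open import Data.List.Membership.Propositional.Properties
  using (∈-∃++; ∈-filter⁺; ∈-filter⁻; ∈-tabulate⁺; ∈-concatMap⁺; ∈-map⁺)
open import Data.List.NonEmpty using (_∷_; last)
open import Data.List.Properties using (map-cong-local; filter-reject; length-++; length-map; length-tabulate)
open import Data.List.Relation.Binary.Permutation.Propositional using (_↭_; ↭-trans; ↭-reflexive; ↭⇒↭ₛ; prep)
open import Data.List.Relation.Binary.Permutation.Propositional.Properties
  using (shift; ∈-resp-↭; All-resp-↭; ↭-length; map⁺)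
import Data.List.Relation.Binary.Permutation.Setoid.Properties as ↭ₛ
open import Data.List.Relation.Unary.All as All using (All; []; _∷_; all?)
open import Data.List.Relation.Unary.All.Properties using (++⁺; replicate⁺; ¬All⇒Any¬)
open import Data.List.Relation.Unary.AllPairs using ([]; _∷_)
open import Data.List.Relation.Unary.Any using (here; there; index; any?)
open import Data.List.Relation.Unary.Any.Properties using (lookup-index)
open import Data.List.Relation.Unary.Linked using (Linked; [-]; _∷_)
open import Data.List.Relation.Unary.Unique.Propositional using (Unique)
open import Data.Nat using (zero; suc; _∸_; _^_; _≤_; _<_; _≤ᵇ_; _≤?_; z≤n; s≤s)
open import Data.Nat.ListAction using (sum)
open import Data.Nat.ListAction.Properties using (sum-↭)
open import Data.Nat.Properties hiding (_≟_; suc-injective)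
open import Data.Nat.Tactic.RingSolver using (solve-∀)
open import Data.Product using (Σ; Σ-syntax; _,_; proj₁; proj₂)
open import Data.Product.Function.Dependent.Propositional using (Σ-↔)
open import Data.Product.Function.NonDependent.Propositional using (_×-↔_)
open import Data.Rational.Properties using (fromℚᵘ-cong)
open import Data.Rational.Unnormalised using (mkℚᵘ; *≡*)
open import Data.Sum using (_⊎_; inj₁; inj₂; [_,_]′)
open import Data.Sum.Function.Propositional using (_⊎-↔_)
open import Data.Unit using (⊤; tt)
open import Function using (_∘_)
open import Function.Bundles using (_↔_; _↣_; Injection; Inverse; mk↔ₛ′)
open import Function.Properties.Inverse using (↔-refl; ↔-sym; ↔-trans; ↔⇒↣)
open import Relation.Binary.Construct.Closure.Equivalence as EqClosure using (EqClosure)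
open import Relation.Binary.Construct.Closure.ReflexiveTransitive using (ε; _◅_; _◅◅_)
open import Relation.Binary.Construct.Closure.Symmetric using (fwd; bwd)
open import Relation.Binary.Definitions using (DecidableEquality)
open import Relation.Binary.PropositionalEquality
open import Relation.Nullary using (¬_; yes; no; does; contradiction)
open import Relation.Nullary.Decidable using (decidable-stable; from-yes; ¬¬-excluded-middle)

open Digraph

-- Chains

-- Derives x ≤ y from m ≤ n by an identity with slack r.
≤-from : ∀ {m n x y} → m ≤ n → ∀ r → x + n + r ≡ y + m → x ≤ y
≤-from {m} {n} {x} {y} m≤n r eq = +-cancelʳ-≤ m x y (begin
  x + m      ≤⟨ +-monoʳ-≤ x m≤n ⟩
  x + n      ≤⟨ m≤m+n (x + n) r ⟩
  x + n + r  ≡⟨ eq ⟩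
  y + m      ∎)
  where open ≤-Reasoning

m≤d*m : ∀ {d} m → 1 ≤ d → m ≤ d * m
m≤d*m m 1≤d = ≤-trans (≤-reflexive (sym (*-identityˡ m))) (*-monoˡ-≤ m 1≤d)

top tot : List ℕ → ℕ
top []       = 1
top (d ∷ ds) = 1 + d * top ds
tot []       = 1
tot (d ∷ ds) = tot ds + top (d ∷ ds)

value : List ℕ → ℕ → ℕ
value []       α = 1 + α
value (d ∷ ds) α = (1 + α) + value ds (d * (1 + α))

value≡tot+top : ∀ ds α → value ds α ≡ tot ds + α * top ds
value≡tot+top []       α = cong suc (sym (*-identityʳ α))
value≡tot+top (d ∷ ds) α = trans (cong (λ n → 1 + α + n) (value≡tot+top ds (d * (1 + α))))
  (identity α d (tot ds) (top ds))
  where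
  identity : ∀ α d S T → 1 + α + (S + d * (1 + α) * T) ≡ S + (1 + d * T) + α * (1 + d * T)
  identity = solve-∀

value₀≡tot : ∀ ds → value ds 0 ≡ tot ds
value₀≡tot ds = trans (value≡tot+top ds 0) (+-identityʳ _)

-- T n and S n are top and tot of the chain with n edges which maximises value ds α for all α ≥ 10.
T S : ℕ → ℕ
T 0 = 1
T 1 = 2
T 2 = 3
T 3 = 5
T 4 = 7
T 5 = 11
T 6 = 16
T 7 = 23
T (suc (suc (suc n))) = 1 + 3 * T n
S 0 = 1
S 1 = 3
S 2 = 6
S 3 = 8
S 4 = 13
S 5 = 19
S 6 = 24
S 7 = 42
S (suc (suc (suc n))) = S n + (1 + 3 * T n)

≤-by-threes : (f g : ℕ → ℕ) → (∀ {n} → n < 8 → f n ≤ g n) →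
  (∀ n → f (5 + n) ≤ g (5 + n) → f (8 + n) ≤ g (8 + n)) → ∀ n → f n ≤ g n
≤-by-threes f g base step = go
  where
  go : ∀ n → f n ≤ g n
  go 0 = base (≤ᵇ⇒≤ _ _ tt)
  go 1 = base (≤ᵇ⇒≤ _ _ tt)
  go 2 = base (≤ᵇ⇒≤ _ _ tt)
  go 3 = base (≤ᵇ⇒≤ _ _ tt)
  go 4 = base (≤ᵇ⇒≤ _ _ tt)
  go 5 = base (≤ᵇ⇒≤ _ _ tt)
  go 6 = base (≤ᵇ⇒≤ _ _ tt)
  go 7 = base (≤ᵇ⇒≤ _ _ tt)
  go (suc (suc (suc (suc (suc (suc (suc (suc n)))))))) = step n (go (suc (suc (suc (suc (suc n))))))

T-growth₁ : ∀ n → 25 * T n + 1 ≤ 23 * T (1 + n)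
T-growth₁ = ≤-by-threes _ _
  (from-yes (allUpTo? (λ n → 25 * T n + 1 ≤? 23 * T (1 + n)) 8))
  (λ n ih → ≤-from (*-monoʳ-≤ 3 ih) 0 (identity (T (5 + n)) (T (6 + n))))
  where
  identity : ∀ a b → 25 * (1 + 3 * a) + 1 + 3 * (23 * b) + 0 ≡ 23 * (1 + 3 * b) + 3 * (25 * a + 1)
  identity = solve-∀

T-growth₂ : ∀ n → 47 * T n + 12 ≤ 23 * T (2 + n)
T-growth₂ = ≤-by-threes _ _
  (from-yes (allUpTo? (λ n → 47 * T n + 12 ≤? 23 * T (2 + n)) 8))
  (λ n ih → ≤-from (*-monoʳ-≤ 3 ih) 0 (identity (T (5 + n)) (T (7 + n))))
  where
  identity : ∀ a b → 47 * (1 + 3 * a) + 12 + 3 * (23 * b) + 0 ≡ 23 * (1 + 3 * b) + 3 * (47 * a + 12)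
  identity = solve-∀

T-growth₃ : ∀ n → 3 * T n + 1 ≤ T (3 + n)
T-growth₃ = ≤-by-threes _ _
  (from-yes (allUpTo? (λ n → 3 * T n + 1 ≤? T (3 + n)) 8))
  (λ n _ → ≤-reflexive (+-comm _ 1))

S-growth₁ : ∀ n → S n + 11 * T n + 11 ≤ S (1 + n) + 10 * T (1 + n)
S-growth₁ = ≤-by-threes _ _
  (from-yes (allUpTo? (λ n → S n + 11 * T n + 11 ≤? S (1 + n) + 10 * T (1 + n)) 8))
  (λ n ih → ≤-from (+-mono-≤ ih (T-growth₁ (5 + n))) 0 (identity (T (5 + n)) (T (6 + n)) (S (5 + n)) (S (6 + n))))
  where
  identity : ∀ a b p q →
    p + (1 + 3 * a) + 11 * (1 + 3 * a) + 11 + (q + 10 * b + 23 * b) + 0 ≡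
    q + (1 + 3 * b) + 10 * (1 + 3 * b) + (p + 11 * a + 11 + (25 * a + 1))
  identity = solve-∀

S-growth₂ : ∀ n → S n + 22 * T n + 11 ≤ S (2 + n) + 10 * T (2 + n)
S-growth₂ = ≤-by-threes _ _
  (from-yes (allUpTo? (λ n → S n + 22 * T n + 11 ≤? S (2 + n) + 10 * T (2 + n)) 8))
  (λ n ih → ≤-from (+-mono-≤ ih (T-growth₂ (5 + n))) 0 (identity (T (5 + n)) (T (7 + n)) (S (5 + n)) (S (7 + n))))
  where
  identity : ∀ a b p q →
    p + (1 + 3 * a) + 22 * (1 + 3 * a) + 11 + (q + 10 * b + 23 * b) + 0 ≡
    q + (1 + 3 * b) + 10 * (1 + 3 * b) + (p + 22 * a + 11 + (47 * a + 12))
  identity = solve-∀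

S-growth₃ : ∀ n → S n + 33 * T n + 11 ≤ S (3 + n) + 10 * T (3 + n)
S-growth₃ = ≤-by-threes _ _
  (from-yes (allUpTo? (λ n → S n + 33 * T n + 11 ≤? S (3 + n) + 10 * T (3 + n)) 8))
  (λ n _ → ≤-reflexive (identity (S (8 + n)) (T (8 + n))))
  where
  identity : ∀ p a → p + 33 * a + 11 ≡ p + (1 + 3 * a) + 10 * (1 + 3 * a)
  identity = solve-∀

K : ℕ → ℕ → ℕ
K n α = S n + α * T n

K-step : ∀ d n → S n + (11 * d) * T n + 11 ≤ S (d + n) + 10 * T (d + n) → d * T n + 1 ≤ T (d + n) →
  ∀ α → 10 ≤ α → (1 + α) + K n (d * (1 + α)) ≤ K (d + n) α
K-step d n S-growth T-growth α 10≤α with α ∸ 10 | m+[n∸m]≡n 10≤α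
... | w | refl = ≤-from (+-mono-≤ S-growth (*-monoʳ-≤ w T-growth)) 0
  (identity (S n) (T n) (S (d + n)) (T (d + n)) d w)
  where
  identity : ∀ p a q b d w →
    1 + (10 + w) + (p + d * (1 + (10 + w)) * a) + (q + 10 * b + w * b) + 0 ≡
    q + (10 + w) * b + (p + 11 * d * a + 11 + w * (d * a + 1))
  identity = solve-∀

K-step₁ : ∀ n α → 10 ≤ α → (1 + α) + K n (1 * (1 + α)) ≤ K (1 + n) α
K-step₁ n = K-step 1 n (S-growth₁ n) (T-growth n)
  where
  identity : ∀ a b → 1 * (1 + 3 * a) + 1 + 3 * b + 2 ≡ 1 + 3 * b + 3 * (1 * a + 1)
  identity = solve-∀
  T-growth : ∀ n → 1 * T n + 1 ≤ T (1 + n)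
  T-growth = ≤-by-threes _ _
    (from-yes (allUpTo? (λ n → 1 * T n + 1 ≤? T (1 + n)) 8))
    (λ n ih → ≤-from (*-monoʳ-≤ 3 ih) 2 (identity (T (5 + n)) (T (6 + n))))

K-step₂ : ∀ n α → 10 ≤ α → (1 + α) + K n (2 * (1 + α)) ≤ K (2 + n) α
K-step₂ n = K-step 2 n (S-growth₂ n) (T-growth n)
  where
  identity : ∀ a b → 2 * (1 + 3 * a) + 1 + 3 * b + 1 ≡ 1 + 3 * b + 3 * (2 * a + 1)
  identity = solve-∀
  T-growth : ∀ n → 2 * T n + 1 ≤ T (2 + n)
  T-growth = ≤-by-threes _ _
    (from-yes (allUpTo? (λ n → 2 * T n + 1 ≤? T (2 + n)) 8))
    (λ n ih → ≤-from (*-monoʳ-≤ 3 ih) 1 (identity (T (5 + n)) (T (7 + n))))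

K-step₃ : ∀ n α → 10 ≤ α → (1 + α) + K n (3 * (1 + α)) ≤ K (3 + n) α
K-step₃ n = K-step 3 n (S-growth₃ n) (T-growth₃ n)

K-recurrence : ∀ n α → K (8 + n) α + 3 * K (2 + n) α ≤ 4 * K (5 + n) α + 1
K-recurrence n α = ≤-from (+-mono-≤ (S-recurrence n) (*-monoʳ-≤ α (T-recurrence n))) 0
  (identity α (S (2 + n)) (S (5 + n)) (S (8 + n)) (T (2 + n)) (T (5 + n)) (T (8 + n)))
  where
  T-identity : ∀ a → 1 + 3 * (1 + 3 * a) + 3 * a ≡ 4 * (1 + 3 * a)
  T-identity = solve-∀
  S-identity : ∀ p a → p + (1 + 3 * a) + (1 + 3 * (1 + 3 * a)) + 3 * p ≡ 4 * (p + (1 + 3 * a)) + 1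
  S-identity = solve-∀
  T-recurrence : ∀ n → T (8 + n) + 3 * T (2 + n) ≤ 4 * T (5 + n)
  T-recurrence 0 = ≤ᵇ⇒≤ _ _ tt
  T-recurrence 1 = ≤ᵇ⇒≤ _ _ tt
  T-recurrence 2 = ≤ᵇ⇒≤ _ _ tt
  T-recurrence (suc (suc (suc n))) = ≤-reflexive (T-identity (T (5 + n)))
  S-recurrence : ∀ n → S (8 + n) + 3 * S (2 + n) ≤ 4 * S (5 + n) + 1
  S-recurrence 0 = ≤ᵇ⇒≤ _ _ tt
  S-recurrence 1 = ≤ᵇ⇒≤ _ _ tt
  S-recurrence 2 = ≤ᵇ⇒≤ _ _ tt
  S-recurrence (suc (suc (suc n))) = ≤-reflexive (S-identity (S (5 + n)) (T (5 + n)))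
  identity : ∀ α p q r a b c →
    r + α * c + 3 * (p + α * a) + (4 * q + 1 + α * (4 * b)) + 0 ≡
    4 * (q + α * b) + 1 + (r + 3 * p + α * (c + 3 * a))
  identity = solve-∀

data Small : ℕ → Set where
  one   : Small 1
  two   : Small 2
  three : Small 3

value≤K : ∀ {ds} → All Small ds → ∀ α → 10 ≤ α → value ds α ≤ K (sum ds) α
value≤K []                          α 10≤α = ≤-reflexive (cong suc (sym (*-identityʳ α)))
value≤K {_ ∷ ds} (one   ∷ ds-small) α 10≤α =
  ≤-trans (+-monoʳ-≤ (1 + α) (value≤K ds-small _ (≤-trans 10≤α (m≤n⇒m≤1+n (m≤m+n α _))))) (K-step₁ (sum ds) α 10≤α)
value≤K {_ ∷ ds} (two   ∷ ds-small) α 10≤α =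
  ≤-trans (+-monoʳ-≤ (1 + α) (value≤K ds-small _ (≤-trans 10≤α (m≤n⇒m≤1+n (m≤m+n α _))))) (K-step₂ (sum ds) α 10≤α)
value≤K {_ ∷ ds} (three ∷ ds-small) α 10≤α =
  ≤-trans (+-monoʳ-≤ (1 + α) (value≤K ds-small _ (≤-trans 10≤α (m≤n⇒m≤1+n (m≤m+n α _))))) (K-step₃ (sum ds) α 10≤α)

-- The number of paths gained by inserting j threes into a chain, δ being the gain from the first one.
growth : ℕ → ℕ → ℕ
growth δ zero    = 0
growth δ (suc j) = δ + growth (1 + 3 * δ) j

growth-closed : ∀ δ j → 4 * growth δ j + 2 * j + (2 * δ + 1) ≡ (2 * δ + 1) * 3 ^ j
growth-closed δ zero    = sym (*-identityʳ _)
growth-closed δ (suc j) = begin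
  4 * (δ + growth δ′ j) + 2 * (1 + j) + (2 * δ + 1)  ≡⟨ identity₁ δ (growth δ′ j) j ⟩
  4 * growth δ′ j + 2 * j + (2 * δ′ + 1)             ≡⟨ growth-closed δ′ j ⟩
  (2 * δ′ + 1) * 3 ^ j                               ≡⟨ identity₂ δ (3 ^ j) ⟩
  (2 * δ + 1) * 3 ^ suc j                            ∎
  where
  open ≡-Reasoning
  δ′ : ℕ
  δ′ = 1 + 3 * δ
  identity₁ : ∀ δ g j → 4 * (δ + g) + 2 * (1 + j) + (2 * δ + 1) ≡ 4 * g + 2 * j + (2 * (1 + 3 * δ) + 1)
  identity₁ = solve-∀
  identity₂ : ∀ δ x → (2 * (1 + 3 * δ) + 1) * x ≡ (2 * δ + 1) * (3 * x)
  identity₂ = solve-∀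

K-growth : ∀ j n α δ → K (5 + n) α ≤ δ + K (2 + n) α → K (2 + n + 3 * j) α ≤ K (2 + n) α + growth δ j
K-growth zero    n α δ Δ≤δ rewrite +-identityʳ n = m≤m+n _ 0
K-growth (suc j) n α δ Δ≤δ = begin
  K (2 + n + 3 * suc j) α                  ≡⟨ cong (λ m → K (2 + m) α) (identity n j) ⟩
  K (5 + n + 3 * j) α                      ≤⟨ K-growth j (3 + n) α (1 + 3 * δ) Δ′≤δ′ ⟩
  K (5 + n) α + growth (1 + 3 * δ) j       ≤⟨ +-monoˡ-≤ _ Δ≤δ ⟩
  δ + K (2 + n) α + growth (1 + 3 * δ) j   ≡⟨ cong (_+ growth (1 + 3 * δ) j) (+-comm δ _) ⟩
  K (2 + n) α + δ + growth (1 + 3 * δ) j   ≡⟨ +-assoc (K (2 + n) α) δ _ ⟩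
  K (2 + n) α + growth δ (suc j)           ∎
  where
  open ≤-Reasoning
  identity : ∀ n j → n + 3 * (1 + j) ≡ 3 + n + 3 * j
  identity = solve-∀
  identity′ : ∀ x y z δ → z + (4 * y + 1 + 3 * (δ + x)) + 0 ≡ 1 + 3 * δ + y + (z + 3 * x + 3 * y)
  identity′ = solve-∀
  Δ′≤δ′ : K (8 + n) α ≤ (1 + 3 * δ) + K (5 + n) α
  Δ′≤δ′ = ≤-from (+-mono-≤ (K-recurrence n α) (*-monoʳ-≤ 3 Δ≤δ)) 0
    (identity′ (K (2 + n) α) (K (5 + n) α) (K (8 + n) α) δ)

-- The tree of initial entries is cut off where α ≥ 10. At a leaf, x bounds the value for n edges, and δ its first
-- increment when n grows by 3; this settles n + 3 j edges for all j at once.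
Certificate : ℕ → (n α x δ : ℕ) → Set
Certificate zero       n α x δ = ⊥
Certificate (suc fuel) n α x δ =
  if 10 ≤ᵇ α
  then True (2 ≤ᵇ n) × True (K n α ≤ᵇ x) × True (K (3 + n) α ≤ᵇ δ + K n α)
  else True (3 ≤ᵇ n) × True (1 + α ≤ᵇ x) × branch 1 × branch 2 × branch 3
  where
  branch : ℕ → Set
  branch d = Certificate fuel (n ∸ d) (d * (1 + α)) (x ∸ (1 + α)) δ

certificate-sound : ∀ fuel {n α x δ} → Certificate fuel n α x δ →
  ∀ j {ds} → All Small ds → sum ds ≡ n + 3 * j → value ds α ≤ x + growth δ j
certificate-sound (suc fuel) {n} {α} {x} {δ} cert j {ds} ds-small sum-ds with 10 ≤ᵇ α in 10≤α
certificate-sound (suc fuel) {suc (suc n)} {α} {x} {δ} (_ , K≤x , ΔK≤δ) j {ds} ds-small sum-ds | true = begin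
  value ds α                       ≤⟨ value≤K ds-small α (≤ᵇ⇒≤ 10 α (subst True (sym 10≤α) tt)) ⟩
  K (sum ds) α                     ≡⟨ cong (λ n → K n α) sum-ds ⟩
  K (2 + n + 3 * j) α              ≤⟨ K-growth j n α δ (≤ᵇ⇒≤ _ _ ΔK≤δ) ⟩
  K (2 + n) α + growth δ j         ≤⟨ +-monoˡ-≤ _ (≤ᵇ⇒≤ (K (2 + n) α) x K≤x) ⟩
  x + growth δ j                   ∎
  where open ≤-Reasoning
certificate-sound (suc fuel) {suc (suc (suc n))} {α} {x} {δ} (_ , α<x , cert₁ , cert₂ , cert₃) j ds-small sum-ds | false =
  go ds-small sum-ds
  where
  prepend : ∀ d {n ds} → Certificate fuel n (d * (1 + α)) (x ∸ (1 + α)) δ → All Small ds →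
    d + sum ds ≡ d + (n + 3 * j) → (1 + α) + value ds (d * (1 + α)) ≤ x + growth δ j
  prepend d {n} {ds} cert ds-small sum-ds = begin
    (1 + α) + value ds (d * (1 + α))            ≤⟨ +-monoʳ-≤ (1 + α) (certificate-sound fuel cert j ds-small (+-cancelˡ-≡ d _ _ sum-ds)) ⟩
    (1 + α) + (x ∸ (1 + α) + growth δ j)        ≡⟨ sym (+-assoc (1 + α) _ _) ⟩
    (1 + α) + (x ∸ (1 + α)) + growth δ j        ≡⟨ cong (_+ growth δ j) (m+[n∸m]≡n (≤ᵇ⇒≤ (1 + α) x α<x)) ⟩
    x + growth δ j                              ∎
    where open ≤-Reasoning
  go : ∀ {ds} → All Small ds → sum ds ≡ 3 + n + 3 * j → value ds α ≤ x + growth δ j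
  go (one   ∷ ds-small) = prepend 1 cert₁ ds-small
  go (two   ∷ ds-small) = prepend 2 cert₂ ds-small
  go (three ∷ ds-small) = prepend 3 cert₃ ds-small

record _⊑_ (ds ds′ : List ℕ) : Set where
  constructor _,_
  field
    top-≤ : top ds ≤ top ds′
    tot-≤ : tot ds ≤ tot ds′

⊑-∷ : ∀ d {ds ds′} → ds ⊑ ds′ → (d ∷ ds) ⊑ (d ∷ ds′)
⊑-∷ d (top≤ , tot≤) = s≤s (*-monoʳ-≤ d top≤) , +-mono-≤ tot≤ (s≤s (*-monoʳ-≤ d top≤))

⊑-trans : ∀ {as bs cs} → as ⊑ bs → bs ⊑ cs → as ⊑ cs
⊑-trans (p , q) (p′ , q′) = ≤-trans p p′ , ≤-trans q q′

prepend-small : ∀ d {ds} → 1 ≤ d → All Small ds →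
  ∃[ ds′ ] (All Small ds′ × sum ds′ ≡ d + sum ds × (d ∷ ds) ⊑ ds′)
prepend-small 1 {ds} _ ds-small = 1 ∷ ds , one ∷ ds-small , refl , (≤-refl , ≤-refl)
prepend-small 2 {ds} _ ds-small = 2 ∷ ds , two ∷ ds-small , refl , (≤-refl , ≤-refl)
prepend-small 3 {ds} _ ds-small = 3 ∷ ds , three ∷ ds-small , refl , (≤-refl , ≤-refl)
prepend-small (suc (suc d@(suc (suc e)))) {ds} _ ds-small with prepend-small d (s≤s z≤n) ds-small
... | ds′ , ds′-small , sum-ds′ , (top≤ , tot≤) =
  2 ∷ ds′ , two ∷ ds′-small , cong (λ n → 2 + n) sum-ds′ ,
  ( ≤-from (*-monoʳ-≤ 2 top≤) (2 + e * top ds) (identity₁ e (top ds) (top ds′))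
  , ≤-from (+-mono-≤ tot≤ top≤) (2 + top ds′ + e * top ds) (identity₂ e (top ds) (top ds′) (tot ds) (tot ds′)) )
  where
  identity₁ : ∀ e t t′ → (1 + (4 + e) * t) + 2 * t′ + (2 + e * t) ≡ (1 + 2 * t′) + 2 * (1 + (2 + e) * t)
  identity₁ = solve-∀
  identity₂ : ∀ e t t′ s s′ → s + (1 + (4 + e) * t) + (s′ + t′) + (2 + t′ + e * t) ≡
    s′ + (1 + 2 * t′) + (s + (1 + (2 + e) * t) + (1 + (2 + e) * t))
  identity₂ = solve-∀

small-⊒ : ∀ {ds} → All (1 ≤_) ds → ∃[ ds′ ] (All Small ds′ × sum ds′ ≡ sum ds × ds ⊑ ds′)
small-⊒ [] = [] , [] , refl , (≤-refl , ≤-refl)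
small-⊒ {d ∷ ds} (1≤d ∷ 1≤ds) =
  let ds₁ , ds₁-small , sum-ds₁ , ds⊑ds₁ = small-⊒ 1≤ds
      ds₂ , ds₂-small , sum-ds₂ , dds₁⊑ds₂ = prepend-small d 1≤d ds₁-small
  in ds₂ , ds₂-small , trans sum-ds₂ (cong (λ n → d + n) sum-ds₁) , ⊑-trans (⊑-∷ d ds⊑ds₁) dds₁⊑ds₂

pad : ∀ m {ds} → All (1 ≤_) ds → ∃[ ds′ ] (All (1 ≤_) ds′ × sum ds′ ≡ m + sum ds × tot ds ≤ tot ds′)
pad zero    {ds} 1≤ds = ds , 1≤ds , refl , ≤-refl
pad (suc m) 1≤ds =
  let ds′ , 1≤ds′ , sum-ds′ , tot≤ = pad m 1≤ds
  in 1 ∷ ds′ , ≤-refl ∷ 1≤ds′ , cong suc sum-ds′ , ≤-trans tot≤ (m≤m+n _ _)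

baseEdgeCount baseTot baseGrowth : Fin 3 → ℕ
baseEdgeCount 0F = 18
baseEdgeCount 1F = 16
baseEdgeCount 2F = 17
baseTot 0F = 2449
baseTot 1F = 1194
baseTot 2F = 1709
baseGrowth 0F = 4900
baseGrowth 1F = 2380
baseGrowth 2F = 3415

maxTot : ℕ → Fin 3 → ℕ
maxTot j i = baseTot i + growth (baseGrowth i) j

certificate : ∀ i → Certificate 11 (baseEdgeCount i) 0 (baseTot i) (baseGrowth i)
certificate 0F = _
certificate 1F = _
certificate 2F = _

tot≤maxTot : ∀ j i {ds} → All (1 ≤_) ds → sum ds ≤ baseEdgeCount i + 3 * j → tot ds ≤ maxTot j i
tot≤maxTot j i {ds} 1≤ds sum≤ =
  let ds₁ , 1≤ds₁ , sum-ds₁ , tot≤₁ = pad (baseEdgeCount i + 3 * j ∸ sum ds) 1≤ds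
      ds₂ , ds₂-small , sum-ds₂ , (_ , tot≤₂) = small-⊒ 1≤ds₁
  in begin
  tot ds         ≤⟨ ≤-trans tot≤₁ tot≤₂ ⟩
  tot ds₂        ≡⟨ sym (value₀≡tot ds₂) ⟩
  value ds₂ 0    ≤⟨ certificate-sound 11 {baseEdgeCount i} {0} {baseTot i} {baseGrowth i} (certificate i) j ds₂-small
                      (trans sum-ds₂ (trans sum-ds₁ (m∸n+n≡m sum≤))) ⟩
  maxTot j i     ∎
  where open ≤-Reasoning

extremal : ℕ → Fin 3 → List ℕ
extremal j 0F = 1 ∷ 2 ∷ replicate j 3 ++ 3 ∷ 3 ∷ 3 ∷ 3 ∷ 2 ∷ 1 ∷ []
extremal j 1F = 1 ∷ 2 ∷ 2 ∷ replicate j 3 ++ 3 ∷ 3 ∷ 2 ∷ 2 ∷ 1 ∷ []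
extremal j 2F = 1 ∷ 2 ∷ replicate j 3 ++ 3 ∷ 3 ∷ 3 ∷ 2 ∷ 2 ∷ 1 ∷ []

extremal≥1 : ∀ j i → All (1 ≤_) (extremal j i)
extremal≥1 j i = go i
  where
  threes : ∀ {ds} → All (1 ≤_) ds → All (1 ≤_) (replicate j 3 ++ ds)
  threes = ++⁺ (replicate⁺ j (s≤s z≤n))
  ≥1 : ∀ {d} → 1 ≤ suc d
  ≥1 = s≤s z≤n
  go : ∀ i → All (1 ≤_) (extremal j i)
  go 0F = ≥1 ∷ ≥1 ∷ threes (≥1 ∷ ≥1 ∷ ≥1 ∷ ≥1 ∷ ≥1 ∷ ≥1 ∷ [])
  go 1F = ≥1 ∷ ≥1 ∷ ≥1 ∷ threes (≥1 ∷ ≥1 ∷ ≥1 ∷ ≥1 ∷ ≥1 ∷ [])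
  go 2F = ≥1 ∷ ≥1 ∷ threes (≥1 ∷ ≥1 ∷ ≥1 ∷ ≥1 ∷ ≥1 ∷ ≥1 ∷ [])

value-threes : ∀ j ds α →
  value (replicate j 3 ++ ds) α ≡ value ds α + growth (1 + α + (2 * α + 3) * top ds) j
value-threes zero    ds α = sym (+-identityʳ _)
value-threes (suc j) ds α = begin
  (1 + α) + value (replicate j 3 ++ ds) α′                             ≡⟨ cong (λ n → 1 + α + n) (value-threes j ds α′) ⟩
  (1 + α) + (value ds α′ + growth (1 + α′ + (2 * α′ + 3) * top ds) j)  ≡⟨ cong (λ δ → (1 + α) + (value ds α′ + growth δ j)) (identity₁ α (top ds)) ⟩
  (1 + α) + (value ds α′ + g)                                          ≡⟨ cong (λ v → (1 + α) + (v + g)) (value≡tot+top ds α′) ⟩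
  (1 + α) + (tot ds + α′ * top ds + g)                                 ≡⟨ identity₂ α (tot ds) (top ds) g ⟩
  tot ds + α * top ds + (δ + g)                                        ≡⟨ cong (_+ (δ + g)) (sym (value≡tot+top ds α)) ⟩
  value ds α + (δ + g)                                                 ∎
  where
  open ≡-Reasoning
  α′ δ g : ℕ
  α′ = 3 * (1 + α)
  δ = 1 + α + (2 * α + 3) * top ds
  g = growth (1 + 3 * δ) j
  identity₁ : ∀ α t → 1 + 3 * (1 + α) + (2 * (3 * (1 + α)) + 3) * t ≡ 1 + 3 * (1 + α + (2 * α + 3) * t)
  identity₁ = solve-∀
  identity₂ : ∀ α s t g → 1 + α + (s + 3 * (1 + α) * t + g) ≡ s + α * t + (1 + α + (2 * α + 3) * t + g)
  identity₂ = solve-∀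

tot-extremal : ∀ j i → tot (extremal j i) ≡ maxTot j i
tot-extremal j i = trans (sym (value₀≡tot (extremal j i))) (value-extremal i)
  where
  combine : ∀ {c v v₀ δ δ₀ x} → x ≡ v + growth δ j → c + v ≡ v₀ → δ ≡ δ₀ → c + x ≡ v₀ + growth δ₀ j
  combine {c} {v} refl refl refl = sym (+-assoc c v _)
  value-extremal : ∀ i → value (extremal j i) 0 ≡ maxTot j i
  value-extremal 0F = combine {3} {v₀ = baseTot 0F} {δ₀ = baseGrowth 0F} (value-threes j (3 ∷ 3 ∷ 3 ∷ 3 ∷ 2 ∷ 1 ∷ []) 4) refl refl
  value-extremal 1F = combine {8} {v₀ = baseTot 1F} {δ₀ = baseGrowth 1F} (value-threes j (3 ∷ 3 ∷ 2 ∷ 2 ∷ 1 ∷ []) 10) refl refl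
  value-extremal 2F = combine {3} {v₀ = baseTot 2F} {δ₀ = baseGrowth 2F} (value-threes j (3 ∷ 3 ∷ 3 ∷ 2 ∷ 2 ∷ 1 ∷ []) 4) refl refl

sum-threes : ∀ j ds → sum (replicate j 3 ++ ds) ≡ sum ds + 3 * j
sum-threes zero    ds = sym (+-identityʳ _)
sum-threes (suc j) ds = trans (cong (λ n → 3 + n) (sum-threes j ds)) (identity (sum ds) j)
  where
  identity : ∀ s j → 3 + (s + 3 * j) ≡ s + 3 * (1 + j)
  identity = solve-∀

sum-extremal : ∀ j i → sum (extremal j i) ≡ baseEdgeCount i + 3 * j
sum-extremal j 0F = cong (λ n → 3 + n) (sum-threes j (3 ∷ 3 ∷ 3 ∷ 3 ∷ 2 ∷ 1 ∷ []))
sum-extremal j 1F = cong (λ n → 5 + n) (sum-threes j (3 ∷ 3 ∷ 2 ∷ 2 ∷ 1 ∷ []))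
sum-extremal j 2F = cong (λ n → 3 + n) (sum-threes j (3 ∷ 3 ∷ 3 ∷ 2 ∷ 2 ∷ 1 ∷ []))

quarter : ∀ a b c d p x → a * x + d ≡ p * 4 + b * c →
  + p / 1 ≡ (+ a ℤ.* + x ℤ.- + b ℤ.* + c ℤ.+ + d) / 4
quarter a b c d p x eq = fromℚᵘ-cong {mkℚᵘ (+ p) 0} {mkℚᵘ (+ a ℤ.* + x ℤ.- + b ℤ.* + c ℤ.+ + d) 3}
  (*≡* (trans (sym over-ℤ) (sym (ℤ.*-identityʳ _))))
  where
  open ≡-Reasoning
  over-ℤ : + a ℤ.* + x ℤ.- + b ℤ.* + c ℤ.+ + d ≡ + p ℤ.* + 4
  over-ℤ = begin
    + a ℤ.* + x ℤ.- + b ℤ.* + c ℤ.+ + d         ≡⟨ cong₂ (λ u v → u ℤ.- v ℤ.+ + d) (sym (ℤ.pos-* a x)) (sym (ℤ.pos-* b c)) ⟩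
    + (a * x) ℤ.- + (b * c) ℤ.+ + d             ≡⟨ ℤ.+-assoc (+ (a * x)) (ℤ.- + (b * c)) (+ d) ⟩
    + (a * x) ℤ.+ (ℤ.- + (b * c) ℤ.+ + d)       ≡⟨ cong (λ z → + (a * x) ℤ.+ z) (ℤ.+-comm (ℤ.- + (b * c)) (+ d)) ⟩
    + (a * x) ℤ.+ (+ d ℤ.- + (b * c))           ≡⟨ sym (ℤ.+-assoc (+ (a * x)) (+ d) (ℤ.- + (b * c))) ⟩
    + (a * x + d) ℤ.- + (b * c)                 ≡⟨ cong (λ n → + n ℤ.- + (b * c)) eq ⟩
    + (p * 4 + b * c) ℤ.- + (b * c)             ≡⟨ ℤ.+-assoc (+ (p * 4)) (+ (b * c)) (ℤ.- + (b * c)) ⟩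
    + (p * 4) ℤ.+ (+ (b * c) ℤ.- + (b * c))     ≡⟨ cong (λ z → + (p * 4) ℤ.+ z) (ℤ.+-inverseʳ (+ (b * c))) ⟩
    + (p * 4) ℤ.+ + 0                           ≡⟨ ℤ.+-identityʳ _ ⟩
    + (p * 4)                                   ≡⟨ ℤ.pos-* p 4 ⟩
    + p ℤ.* + 4                                 ∎

baseQuotient : Fin 3 → ℕ
baseQuotient 0F = 6
baseQuotient 1F = 5
baseQuotient 2F = 5

maxTot-formula : ∀ j i → (+ maxTot j i) / 1 ≡ pathCountFormula (baseQuotient i + j) i
maxTot-formula j i = formula i
  where
  over-ℕ : ∀ a e b δ d q → a * 3 ^ e ≡ 2 * δ + 1 → 2 * δ + 1 + d ≡ 4 * b + 2 * q →
    a * 3 ^ (e + j) + d ≡ (b + growth δ j) * 4 + 2 * (q + j)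
  over-ℕ a e b δ d q eq₁ eq₂ = begin
    a * 3 ^ (e + j) + d                    ≡⟨ cong (λ x → a * x + d) (^-distribˡ-+-* 3 e j) ⟩
    a * (3 ^ e * 3 ^ j) + d                ≡⟨ cong (_+ d) (sym (*-assoc a (3 ^ e) (3 ^ j))) ⟩
    a * 3 ^ e * 3 ^ j + d                  ≡⟨ cong (λ c → c * 3 ^ j + d) eq₁ ⟩
    c * 3 ^ j + d                          ≡⟨ cong (_+ d) (sym (growth-closed δ j)) ⟩
    4 * g + 2 * j + c + d                  ≡⟨ +-assoc (4 * g + 2 * j) c d ⟩
    4 * g + 2 * j + (c + d)                ≡⟨ cong (λ n → 4 * g + 2 * j + n) eq₂ ⟩
    4 * g + 2 * j + (4 * b + 2 * q)        ≡⟨ identity g j b q ⟩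
    (b + g) * 4 + 2 * (q + j)              ∎
    where
    open ≡-Reasoning
    c g : ℕ
    c = 2 * δ + 1
    g = growth δ j
    identity : ∀ g j b q → 4 * g + 2 * j + (4 * b + 2 * q) ≡ (b + g) * 4 + 2 * (q + j)
    identity = solve-∀
  formula : ∀ i → (+ maxTot j i) / 1 ≡ pathCountFormula (baseQuotient i + j) i
  formula 0F = quarter 121 2 (6 + j) 7 (maxTot j 0F) (3 ^ (4 + j))
    (over-ℕ 121 4 (baseTot 0F) (baseGrowth 0F) 7 6 refl refl)
  formula 1F = quarter 529 2 (5 + j) 25 (maxTot j 1F) (3 ^ (2 + j))
    (over-ℕ 529 2 (baseTot 1F) (baseGrowth 1F) 25 5 refl refl)
  formula 2F = quarter 253 2 (5 + j) 15 (maxTot j 2F) (3 ^ (3 + j))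
    (over-ℕ 253 3 (baseTot 2F) (baseGrowth 2F) 15 5 refl refl)

-- Chains as graphs

last-∷ : ∀ {A : Set} (e f : A) es → last (e ∷ f ∷ es) ≡ last (f ∷ es)
last-∷ e f es with initLast es
... | []       = refl
... | _ ∷ʳ′ _  = refl

data Walk (E : Digraph) (v : E⁰ E) : Set where
  stop : Walk E v
  step : (e : E¹ E) → v ≡ s E e → Walk E (t E e) → Walk E v

FP↔Walks : ∀ E → FP E ↔ Σ (E⁰ E) (Walk E)
FP↔Walks E = mk↔ₛ′ to from to∘from from∘to
  where
  Consecutive : E¹ E → E¹ E → Set
  Consecutive e f = t E e ≡ s E f
  toWalk : ∀ {e es} → Linked Consecutive (e ∷ es) → Walk E (t E e)
  toWalk [-]                     = stop
  toWalk (_∷_ {y = f} te≡sf fs)  = step f te≡sf (toWalk fs)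
  edges : ∀ {v} → Walk E v → List (E¹ E)
  edges stop         = []
  edges (step e _ w) = e ∷ edges w
  linked : ∀ e (w : Walk E (t E e)) → Linked Consecutive (e ∷ edges w)
  linked e stop             = [-]
  linked e (step f te≡sf w) = te≡sf ∷ linked f w
  toWalk-linked : ∀ e w → toWalk (linked e w) ≡ w
  toWalk-linked e stop         = refl
  toWalk-linked e (step f p w) = cong (step f p) (toWalk-linked f w)
  extend : ∀ {e f es} → t E e ≡ s E f → Σ[ fs ∈ List (E¹ E) ] Linked Consecutive (f ∷ fs) →
    Σ[ es ∈ List (E¹ E) ] Linked Consecutive (e ∷ es)
  extend {f = f} te≡sf (fs , l) = f ∷ fs , te≡sf ∷ l
  linked-toWalk : ∀ {e es} (l : Linked Consecutive (e ∷ es)) →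
    _≡_ {A = Σ[ es ∈ List (E¹ E) ] Linked Consecutive (e ∷ es)} (edges (toWalk l) , linked e (toWalk l)) (es , l)
  linked-toWalk [-]         = refl
  linked-toWalk {es = es} (te≡sf ∷ l) = cong (extend {es = es} te≡sf) (linked-toWalk l)
  to : FP E → Σ (E⁰ E) (Walk E)
  to (inj₁ v)            = v , stop
  to (inj₂ (e ∷ es , l)) = s E e , step e refl (toWalk l)
  from : Σ (E⁰ E) (Walk E) → FP E
  from (v , stop)       = inj₁ v
  from (v , step e _ w) = inj₂ (e ∷ edges w , linked e w)
  to∘from : ∀ w → to (from w) ≡ w
  to∘from (v , stop)          = refl
  to∘from (v , step e refl w) = cong (λ w → s E e , step e refl w) (toWalk-linked e w)
  from∘to : ∀ p → from (to p) ≡ p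
  from∘to (inj₁ v)            = refl
  from∘to (inj₂ (e ∷ es , l)) = cong (λ (es , l) → inj₂ (e ∷ es , l)) (linked-toWalk l)

Edge : List ℕ → Set
Edge []       = ⊥
Edge (d ∷ ds) = Fin d ⊎ Edge ds

source target : ∀ {ds} → Edge ds → Fin (suc (length ds))
source {_ ∷ _} (inj₁ _) = zero
source {_ ∷ _} (inj₂ e) = suc (source e)
target {_ ∷ _} (inj₁ _) = suc zero
target {_ ∷ _} (inj₂ e) = suc (target e)

chain : List ℕ → Digraph
chain ds = record { E⁰ = Fin (suc (length ds)) ; E¹ = Edge ds ; s = source ; t = target }

chain-connected : ∀ {ds} → All (1 ≤_) ds → Connected (chain ds)
chain-connected {ds} 1≤ds u v = EqClosure.symmetric _ (from-zero 1≤ds u) ◅◅ from-zero 1≤ds v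
  where
  from-zero : ∀ {ds} → All (1 ≤_) ds → ∀ v → EqClosure (Adjacent (chain ds)) zero v
  from-zero _              zero    = ε
  from-zero (s≤s _ ∷ 1≤ds) (suc v) =
    fwd (inj₁ zero , refl , refl) ◅
    EqClosure.gmap suc (λ (e , p , q) → inj₂ e , cong suc p , cong suc q) (from-zero 1≤ds v)

source<target : ∀ {ds} (e : Edge ds) → toℕ (source e) < toℕ (target e)
source<target {_ ∷ _} (inj₁ _) = s≤s z≤n
source<target {_ ∷ _} (inj₂ e) = s≤s (source<target e)

chain-acyclic : ∀ ds → Acyclic (chain ds)
chain-acyclic ds (e ∷ es , linked) eq = <-irrefl (cong toℕ eq) (ascends e es linked)
  where
  ascends : ∀ e es → Linked (λ e f → target e ≡ source f) (e ∷ es) → toℕ (source e) < toℕ (target {ds} (last (e ∷ es)))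
  ascends e []       [-]         = source<target e
  ascends e (f ∷ es) (te≡sf ∷ l) rewrite last-∷ e f es =
    <-trans (source<target e) (subst (λ v → toℕ v < _) (sym te≡sf) (ascends f es l))

chain-edges : ∀ ds → HasEdgeCount (chain ds) (sum ds)
chain-edges []       = ↔-sym 0↔⊥
chain-edges (d ∷ ds) = ↔-trans (↔-refl ⊎-↔ chain-edges ds) (↔-sym +↔⊎)

walks-above : ∀ d ds v → Walk (chain (d ∷ ds)) (suc v) ↔ Walk (chain ds) v
walks-above d ds v = mk↔ₛ′ down up down∘up up∘down
  where
  down : ∀ {v} → Walk (chain (d ∷ ds)) (suc v) → Walk (chain ds) v
  down stop                = stop
  down (step (inj₂ e) p w) = step e (suc-injective p) (down w)
  up : ∀ {v} → Walk (chain ds) v → Walk (chain (d ∷ ds)) (suc v)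
  up stop         = stop
  up (step e p w) = step (inj₂ e) (cong suc p) (up w)
  down∘up : ∀ {v} (w : Walk (chain ds) v) → down (up w) ≡ w
  down∘up stop            = refl
  down∘up (step e refl w) = cong (step e refl) (down∘up w)
  up∘down : ∀ {v} (w : Walk (chain (d ∷ ds)) (suc v)) → up (down w) ≡ w
  up∘down stop                   = refl
  up∘down (step (inj₂ e) refl w) = cong (step (inj₂ e) refl) (up∘down w)

walks-zero : ∀ d ds → Walk (chain (d ∷ ds)) zero ↔ (⊤ ⊎ (Fin d × Walk (chain (d ∷ ds)) (suc zero)))
walks-zero d ds = mk↔ₛ′ to from to∘from from∘to
  where
  to : Walk (chain (d ∷ ds)) zero → ⊤ ⊎ (Fin d × Walk (chain (d ∷ ds)) (suc zero))
  to stop                = inj₁ tt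
  to (step (inj₁ i) _ w) = inj₂ (i , w)
  from : ⊤ ⊎ (Fin d × Walk (chain (d ∷ ds)) (suc zero)) → Walk (chain (d ∷ ds)) zero
  from (inj₁ _)       = stop
  from (inj₂ (i , w)) = step (inj₁ i) refl w
  to∘from : ∀ x → to (from x) ≡ x
  to∘from (inj₁ _) = refl
  to∘from (inj₂ _) = refl
  from∘to : ∀ w → from (to w) ≡ w
  from∘to stop                   = refl
  from∘to (step (inj₁ i) refl w) = refl

walks-[] : Walk (chain []) zero ↔ Fin 1
walks-[] = mk↔ₛ′ (λ _ → zero) (λ _ → stop) (λ { zero → refl }) (λ { stop → refl ; (step () _ _) })

walks-top : ∀ ds → Walk (chain ds) zero ↔ Fin (top ds)
walks-top []       = walks-[]
walks-top (d ∷ ds) = ↔-trans (walks-zero d ds)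
  (↔-trans (↔-sym 1↔⊤ ⊎-↔ ↔-trans (↔-refl ×-↔ ↔-trans (walks-above d ds zero) (walks-top ds)) (↔-sym *↔×))
           (↔-sym +↔⊎))

walks-tot : ∀ ds → Σ (E⁰ (chain ds)) (Walk (chain ds)) ↔ Fin (tot ds)
walks-tot []       = mk↔ₛ′ (λ _ → zero) (λ _ → zero , stop) (λ { zero → refl }) (λ { (zero , stop) → refl ; (zero , step () _ _) })
walks-tot (d ∷ ds) = ↔-trans split
  (↔-trans (↔-trans above (walks-tot ds) ⊎-↔ walks-top (d ∷ ds)) (↔-sym +↔⊎))
  where
  W : Fin (suc (suc (length ds))) → Set
  W = Walk (chain (d ∷ ds))
  split : Σ (Fin (suc (suc (length ds)))) W ↔ (Σ (Fin (suc (length ds))) (λ v → W (suc v)) ⊎ W zero)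
  split = mk↔ₛ′ (λ { (zero , w) → inj₂ w ; (suc v , w) → inj₁ (v , w) })
                (λ { (inj₁ (v , w)) → suc v , w ; (inj₂ w) → zero , w })
                (λ { (inj₁ _) → refl ; (inj₂ _) → refl })
                (λ { (zero , w) → refl ; (suc v , w) → refl })
  above : Σ (Fin (suc (length ds))) (λ v → W (suc v)) ↔ Σ (Fin (suc (length ds))) (Walk (chain ds))
  above = Σ-↔ ↔-refl (λ {v} → walks-above d ds v)

chain-paths : ∀ ds → FP (chain ds) ↔ Fin (tot ds)
chain-paths ds = ↔-trans (FP↔Walks (chain ds)) (walks-tot ds)

-- Reduction of arbitrary graphs to chains

-- As top and tot, but with a first vertex whose edges lead nowhere: the last entry of the list is irrelevant.
top₀ tot₀ : List ℕ → ℕ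
top₀ []       = 0
top₀ (d ∷ ds) = 1 + d * top₀ ds
tot₀ []       = 0
tot₀ (d ∷ ds) = tot₀ ds + top₀ (d ∷ ds)

drop-last : ∀ {d ds} → All (1 ≤_) (d ∷ ds) →
  ∃[ ds′ ] (All (1 ≤_) ds′ × 1 + sum ds′ ≤ sum (d ∷ ds) × top ds′ ≡ top₀ (d ∷ ds) × tot ds′ ≡ tot₀ (d ∷ ds))
drop-last {d} (1≤d ∷ []) = [] , [] , ≤-trans 1≤d (m≤m+n d 0) , cong suc (sym (*-zeroʳ d)) , cong suc (sym (*-zeroʳ d))
drop-last {d} (1≤d ∷ 1≤ds@(_ ∷ _)) =
  let ds′ , 1≤ds′ , sum≤ , top≡ , tot≡ = drop-last 1≤ds
  in d ∷ ds′ , 1≤d ∷ 1≤ds′ , ≤-trans (≤-reflexive (sym (+-suc d _))) (+-monoʳ-≤ d sum≤) ,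
     cong (λ n → 1 + d * n) top≡ , cong₂ (λ m n → m + (1 + d * n)) tot≡ top≡

∈⇒↭ : ∀ {A : Set} {x : A} {xs} → x ∈ xs → ∃[ ys ] xs ↭ x ∷ ys
∈⇒↭ {x = x} x∈xs with ys , zs , xs≡ ← ∈-∃++ x∈xs = ys ++ zs , ↭-trans (↭-reflexive xs≡) (shift x ys zs)

Unique-resp-↭ : ∀ {A : Set} {xs ys : List A} → xs ↭ ys → Unique xs → Unique ys
Unique-resp-↭ xs↭ys = ↭ₛ.Unique-resp-↭ (setoid _) (↭⇒↭ₛ xs↭ys)

∉⇒≢ : ∀ {A : Set} {u v : A} {vs} → u ∉ v ∷ vs → u ≢ v
∉⇒≢ u∉ u≡v = u∉ (here u≡v)

module UnionFind {V : Set} (_≟_ : DecidableEquality V) where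

  relabel : V → V → V → V
  relabel p q u = if does (u ≟ p) then q else u

  relabel-≡ : ∀ p q → relabel p q p ≡ q
  relabel-≡ p q with p ≟ p
  ... | yes _  = refl
  ... | no p≢p = contradiction refl p≢p

  relabel-≢ : ∀ {p u} q → u ≢ p → relabel p q u ≡ u
  relabel-≢ {p} {u} q u≢p with u ≟ p
  ... | yes u≡p = contradiction u≡p u≢p
  ... | no _    = refl

  update : V → ℕ → (V → ℕ) → V → ℕ
  update v m M u = if does (u ≟ v) then m else M u

  update-≡ : ∀ v m M → update v m M v ≡ m
  update-≡ v m M with v ≟ v
  ... | yes _  = refl
  ... | no v≢v = contradiction refl v≢v

  update-≢ : ∀ {v u} m M → u ≢ v → update v m M u ≡ M u
  update-≢ {v} {u} m M u≢v with u ≟ v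
  ... | yes u≡v = contradiction u≡v u≢v
  ... | no _    = refl

  update-≤ : ∀ v m M → M v ≤ m → ∀ u → M u ≤ update v m M u
  update-≤ v m M Mv≤m u with u ≟ v
  ... | yes refl = Mv≤m
  ... | no _     = ≤-refl

  sum-update : ∀ v m M {us} → All (v ≢_) us → sum (map (update v m M) us) ≡ sum (map M us)
  sum-update v m M v∉us = cong sum (map-cong-local (All.map (λ v≢u → update-≢ m M (v≢u ∘ sym)) v∉us))

module Bound (E : Digraph) (_≟_ : DecidableEquality (E⁰ E)) (es : List (E¹ E)) where

  open UnionFind _≟_
  open import Data.List.Membership.DecPropositional _≟_ using (_∈?_)

  out : E⁰ E → List (E¹ E)
  out v = filter (λ e → v ≟ s E e) es

  walkCount : ℕ → E⁰ E → ℕ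
  walkCount zero    v = 1
  walkCount (suc k) v = 1 + sum (map (λ e → walkCount k (t E e)) (out v))

  1≤walkCount : ∀ k v → 1 ≤ walkCount k v
  1≤walkCount zero    v = ≤-refl
  1≤walkCount (suc k) v = s≤s z≤n

  data TopologicalOrder : List (E⁰ E) → Set where
    []   : TopologicalOrder []
    cons : ∀ {v vs} → v ∉ vs → All (λ e → t E e ∈ vs) (out v) → TopologicalOrder vs → TopologicalOrder (v ∷ vs)

  outCount : List (E⁰ E) → ℕ
  outCount vs = sum (map (length ∘ out) vs)

  -- The components of the part of the graph spanned by vs, W being the list of all vertices. A component is given by
  -- its root, label maps vertices to roots, and vertices outside vs form components of their own, with M = 0.
  record State (W vs : List (E⁰ E)) : Set where
    field
      ds         : List ℕ
      roots      : List (E⁰ E)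
      label      : E⁰ E → E⁰ E
      M          : E⁰ E → ℕ
      1≤ds       : All (1 ≤_) ds
      unique     : Unique roots
      label∈     : ∀ u → label u ∈ roots
      label-root : All (λ r → label r ≡ r) roots
      ΣM≤top     : sum (map M roots) ≤ top₀ ds
      fresh      : ∀ {u} → u ∉ vs → label u ≡ u × M u ≡ 0
      count≤M    : ∀ {u} → u ∈ vs → ∀ k → walkCount k u ≤ M (label u)
      Σcount≤tot : ∀ k → sum (map (walkCount k) vs) ≤ tot₀ ds
      same-label : ∀ {e} → e ∈ es → s E e ∈ vs → label (s E e) ≡ label (t E e)
      budget     : sum ds + length W ≡ length vs + outCount vs + length roots

  -- The edges fs of v, which point to vs, have been added. The components met by them are merged under the root v,
  -- M v being the sum of their bounds; the final bound 1 + δ * M v for v is set when all edges of v have been added.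
  record Active (W : List (E⁰ E)) (ds : List ℕ) (v : E⁰ E) (vs : List (E⁰ E)) (fs : List (E¹ E)) : Set where
    field
      δ          : ℕ
      others     : List (E⁰ E)
      label      : E⁰ E → E⁰ E
      M          : E⁰ E → ℕ
      1≤δ        : 1 ≤ δ
      unique     : Unique (v ∷ others)
      label∈     : ∀ u → label u ∈ v ∷ others
      label-root : All (λ r → label r ≡ r) (v ∷ others)
      ΣM≤top     : M v + sum (map M others) ≤ top₀ ds
      fresh      : ∀ {u} → u ∉ v ∷ vs → label u ≡ u × M u ≡ 0
      count≤M    : ∀ {u} → u ∈ vs → ∀ k → walkCount k u ≤ M (label u)
      Σcount≤M   : ∀ k → sum (map (λ e → walkCount k (t E e)) fs) ≤ δ * M v
      same-label : ∀ {e} → e ∈ es → s E e ∈ vs → label (s E e) ≡ label (t E e)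
      label-fs   : All (λ e → label (t E e) ≡ v) fs
      budget     : sum ds + δ + length W ≡ 1 + length vs + (outCount vs + length fs) + (1 + length others)

  activate : ∀ {W vs v} → v ∉ vs → (σ : State W vs) → Active W (State.ds σ) v vs []
  activate {W} {vs} {v} v∉vs σ = record
    { δ          = 1
    ; others     = others
    ; label      = label
    ; M          = M
    ; 1≤δ        = ≤-refl
    ; unique     = Unique-resp-↭ roots↭ unique
    ; label∈     = λ u → ∈-resp-↭ roots↭ (label∈ u)
    ; label-root = All-resp-↭ roots↭ label-root
    ; ΣM≤top     = ≤-trans (≤-reflexive (sym (sum-↭ (map⁺ M roots↭)))) ΣM≤top
    ; fresh      = λ u∉ → fresh (u∉ ∘ there)
    ; count≤M    = count≤M
    ; Σcount≤M   = λ k → z≤n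
    ; same-label = same-label
    ; label-fs   = []
    ; budget     = begin
        sum ds + 1 + length W                                      ≡⟨ identity₁ (sum ds) (length W) ⟩
        1 + (sum ds + length W)                                    ≡⟨ cong suc budget ⟩
        1 + (length vs + outCount vs + length roots)               ≡⟨ cong (λ n → 1 + (length vs + outCount vs + n)) (↭-length roots↭) ⟩
        1 + (length vs + outCount vs + (1 + length others))        ≡⟨ identity₂ (length vs) (outCount vs) (length others) ⟩
        1 + length vs + (outCount vs + 0) + (1 + length others)    ∎
    }
    where
    open State σ
    open ≡-Reasoning
    v∈roots : v ∈ roots
    v∈roots = subst (_∈ roots) (proj₁ (fresh v∉vs)) (label∈ v)
    others : List (E⁰ E)
    others = proj₁ (∈⇒↭ v∈roots)
    roots↭ : roots ↭ v ∷ others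
    roots↭ = proj₂ (∈⇒↭ v∈roots)
    identity₁ : ∀ a b → a + 1 + b ≡ 1 + (a + b)
    identity₁ = solve-∀
    identity₂ : ∀ a b c → 1 + (a + b + (1 + c)) ≡ 1 + a + (b + 0) + (1 + c)
    identity₂ = solve-∀

  process-edge : ∀ {W ds v vs fs} e → t E e ∈ vs → Active W ds v vs fs → Active W ds v vs (e ∷ fs)
  process-edge {W} {ds} {v} {vs} {fs} e te∈vs α with Active.label α (t E e) ≟ v
  ... | yes label≡v = record
    { δ          = 1 + δ
    ; others     = others
    ; label      = label
    ; M          = M
    ; 1≤δ        = s≤s z≤n
    ; unique     = unique
    ; label∈     = label∈
    ; label-root = label-root
    ; ΣM≤top     = ΣM≤top
    ; fresh      = fresh
    ; count≤M    = count≤M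
    ; Σcount≤M   = λ k → +-mono-≤ (subst (λ l → walkCount k (t E e) ≤ M l) label≡v (count≤M te∈vs k)) (Σcount≤M k)
    ; same-label = same-label
    ; label-fs   = label≡v ∷ label-fs
    ; budget     = begin
        sum ds + (1 + δ) + length W                                                  ≡⟨ identity₁ (sum ds) δ (length W) ⟩
        1 + (sum ds + δ + length W)                                                  ≡⟨ cong suc budget ⟩
        1 + (1 + length vs + (outCount vs + length fs) + (1 + length others))        ≡⟨ identity₂ (length vs) (outCount vs) (length fs) (length others) ⟩
        1 + length vs + (outCount vs + (1 + length fs)) + (1 + length others)        ∎
    }
    where
    open Active α
    open ≡-Reasoning
    identity₁ : ∀ a b c → a + (1 + b) + c ≡ 1 + (a + b + c)
    identity₁ = solve-∀
    identity₂ : ∀ a b c d → 1 + (1 + a + (b + c) + (1 + d)) ≡ 1 + a + (b + (1 + c)) + (1 + d)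
    identity₂ = solve-∀
  ... | no label≢v = record
    { δ          = δ
    ; others     = rest
    ; label      = relabel p v ∘ label
    ; M          = M′
    ; 1≤δ        = 1≤δ
    ; unique     = v≢rest ∷ unique-rest
    ; label∈     = label∈′
    ; label-root = trans (cong (relabel p v) (All.head label-root)) (relabel-≢ v v≢p)
                 ∷ All.zipWith (λ (p≢r , label-r) → trans (cong (relabel p v) label-r) (relabel-≢ v (p≢r ∘ sym)))
                     (p≢rest , All.tail (All-resp-↭ others↭ (All.tail label-root)))
    ; ΣM≤top     = ≤-trans (≤-reflexive ΣM′≡ΣM) ΣM≤top
    ; fresh      = fresh′
    ; count≤M    = λ u∈vs k → ≤-trans (count≤M u∈vs k) (M≤M′ _)
    ; Σcount≤M   = Σcount≤M′
    ; same-label = λ e∈es se∈vs → cong (relabel p v) (same-label e∈es se∈vs)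
    ; label-fs   = relabel-≡ p v ∷ All.map (λ label≡v → trans (cong (relabel p v) label≡v) (relabel-≢ v v≢p)) label-fs
    ; budget     = begin
        sum ds + δ + length W                                                        ≡⟨ budget ⟩
        1 + length vs + (outCount vs + length fs) + (1 + length others)              ≡⟨ cong (λ n → 1 + length vs + (outCount vs + length fs) + (1 + n)) (↭-length others↭) ⟩
        1 + length vs + (outCount vs + length fs) + (2 + length rest)                ≡⟨ identity (length vs) (outCount vs) (length fs) (length rest) ⟩
        1 + length vs + (outCount vs + (1 + length fs)) + (1 + length rest)          ∎
    }
    where
    open Active α
    open ≡-Reasoning
    identity : ∀ a b c d → 1 + a + (b + c) + (2 + d) ≡ 1 + a + (b + (1 + c)) + (1 + d)
    identity = solve-∀
    p : E⁰ E
    p = label (t E e)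
    ∈-tail : ∀ {u x} {xs : List (E⁰ E)} → u ∈ x ∷ xs → u ≢ x → u ∈ xs
    ∈-tail (here u≡x)   u≢x = contradiction u≡x u≢x
    ∈-tail (there u∈xs) u≢x = u∈xs
    p∈others : p ∈ others
    p∈others = ∈-tail (label∈ (t E e)) label≢v
    rest : List (E⁰ E)
    rest = proj₁ (∈⇒↭ p∈others)
    others↭ : others ↭ p ∷ rest
    others↭ = proj₂ (∈⇒↭ p∈others)
    v≢p : v ≢ p
    v≢p = label≢v ∘ sym
    unique-v∷p∷rest : Unique (v ∷ p ∷ rest)
    unique-v∷p∷rest = Unique-resp-↭ (prep v others↭) unique
    v≢rest : All (v ≢_) rest
    v≢rest with (_ ∷ v≢rest) ∷ _ ← unique-v∷p∷rest = v≢rest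
    p≢rest : All (p ≢_) rest
    p≢rest with _ ∷ p≢rest ∷ _ ← unique-v∷p∷rest = p≢rest
    unique-rest : Unique rest
    unique-rest with _ ∷ _ ∷ unique-rest ← unique-v∷p∷rest = unique-rest
    M′ : E⁰ E → ℕ
    M′ = update v (M v + M p) M
    label∈′ : ∀ u → relabel p v (label u) ∈ v ∷ rest
    label∈′ u with label u ≟ p
    ... | yes _       = here refl
    ... | no label≢p with ∈-resp-↭ (prep v others↭) (label∈ u)
    ...   | here label≡v           = here label≡v
    ...   | there (here label≡p)   = contradiction label≡p label≢p
    ...   | there (there label∈)   = there label∈
    ΣM′≡ΣM : M′ v + sum (map M′ rest) ≡ M v + sum (map M others)
    ΣM′≡ΣM = begin
      M′ v + sum (map M′ rest)          ≡⟨ cong₂ _+_ (update-≡ v _ M) (sum-update v _ M v≢rest) ⟩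
      M v + M p + sum (map M rest)      ≡⟨ +-assoc (M v) (M p) _ ⟩
      M v + sum (map M (p ∷ rest))      ≡⟨ cong (λ n → M v + n) (sym (sum-↭ (map⁺ M others↭))) ⟩
      M v + sum (map M others)          ∎
    1≤Mp : 1 ≤ M p
    1≤Mp = count≤M te∈vs 0
    fresh′ : ∀ {u} → u ∉ v ∷ vs → relabel p v (label u) ≡ u × M′ u ≡ 0
    fresh′ {u} u∉ =
      let label≡u , Mu≡0 = fresh u∉
          u≢p = λ u≡p → 1+n≰n (≤-trans 1≤Mp (≤-reflexive (trans (cong M (sym u≡p)) Mu≡0)))
      in trans (cong (relabel p v) label≡u) (relabel-≢ v u≢p) , trans (update-≢ _ M (∉⇒≢ u∉)) Mu≡0
    M≤M′ : ∀ u → M u ≤ M′ (relabel p v u)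
    M≤M′ u with u ≟ p
    ... | yes refl = ≤-trans (m≤n+m (M p) (M v)) (≤-reflexive (sym (update-≡ v _ M)))
    ... | no _     = update-≤ v _ M (m≤m+n (M v) (M p)) u
    Σcount≤M′ : ∀ k → walkCount k (t E e) + sum (map (λ f → walkCount k (t E f)) fs) ≤ δ * M′ v
    Σcount≤M′ k = ≤-trans (+-mono-≤ (≤-trans (count≤M te∈vs k) (m≤d*m (M p) 1≤δ)) (Σcount≤M k))
      (≤-reflexive (begin
        δ * M p + δ * M v   ≡⟨ +-comm (δ * M p) (δ * M v) ⟩
        δ * M v + δ * M p   ≡⟨ sym (*-distribˡ-+ δ (M v) (M p)) ⟩
        δ * (M v + M p)     ≡⟨ cong (δ *_) (sym (update-≡ v _ M)) ⟩
        δ * M′ v            ∎))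

  process-edges : ∀ {W ds v vs} fs → All (λ e → t E e ∈ vs) fs → Active W ds v vs [] → Active W ds v vs fs
  process-edges []       []             α = α
  process-edges (e ∷ fs) (te∈vs ∷ tfs∈) α = process-edge e te∈vs (process-edges fs tfs∈ α)

  deactivate : ∀ {W vs v} (σ : State W vs) → Active W (State.ds σ) v vs (out v) → State W (v ∷ vs)
  deactivate {W} {vs} {v} σ α = record
    { ds         = δ ∷ ds
    ; roots      = v ∷ others
    ; label      = label
    ; M          = M′
    ; 1≤ds       = 1≤δ ∷ State.1≤ds σ
    ; unique     = unique
    ; label∈     = label∈
    ; label-root = label-root
    ; ΣM≤top     = ΣM′≤top
    ; fresh      = λ u∉ → proj₁ (fresh u∉) , trans (update-≢ _ M (∉⇒≢ u∉)) (proj₂ (fresh u∉))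
    ; count≤M    = count≤M′
    ; Σcount≤tot = λ k → ≤-trans (+-mono-≤ (count-v k) (State.Σcount≤tot σ k))
        (≤-trans (≤-reflexive (+-comm (M′ v) (tot₀ ds))) (+-monoʳ-≤ (tot₀ ds) (≤-trans (m≤m+n (M′ v) _) ΣM′≤top)))
    ; same-label = same-label′
    ; budget     = trans (identity₁ (sum ds) δ (length W))
        (trans budget (identity₂ (length vs) (outCount vs) (length (out v)) (length others)))
    }
    where
    open Active α
    open State σ using (ds)
    open ≤-Reasoning
    M′ : E⁰ E → ℕ
    M′ = update v (1 + δ * M v) M
    M≤M′ : ∀ u → M u ≤ M′ u
    M≤M′ = update-≤ v _ M (m≤n⇒m≤1+n (m≤d*m (M v) 1≤δ))
    ΣM′≤top : M′ v + sum (map M′ others) ≤ 1 + δ * top₀ ds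
    ΣM′≤top with v≢others ∷ _ ← unique = begin
      M′ v + sum (map M′ others)                    ≡⟨ cong₂ _+_ (update-≡ v _ M) (sum-update v _ M v≢others) ⟩
      1 + (δ * M v + sum (map M others))            ≤⟨ s≤s (+-monoʳ-≤ (δ * M v) (m≤d*m _ 1≤δ)) ⟩
      1 + (δ * M v + δ * sum (map M others))        ≡⟨ cong suc (sym (*-distribˡ-+ δ (M v) _)) ⟩
      1 + δ * (M v + sum (map M others))            ≤⟨ s≤s (*-monoʳ-≤ δ ΣM≤top) ⟩
      1 + δ * top₀ ds                               ∎
    count-v : ∀ k → walkCount k v ≤ M′ v
    count-v zero    rewrite update-≡ v (1 + δ * M v) M = s≤s z≤n
    count-v (suc k) rewrite update-≡ v (1 + δ * M v) M = s≤s (Σcount≤M k)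
    label-v : label v ≡ v
    label-v = All.head label-root
    count≤M′ : ∀ {u} → u ∈ v ∷ vs → ∀ k → walkCount k u ≤ M′ (label u)
    count≤M′ (here refl)  k rewrite label-v = count-v k
    count≤M′ (there u∈vs) k = ≤-trans (count≤M u∈vs k) (M≤M′ _)
    same-label′ : ∀ {e} → e ∈ es → s E e ∈ v ∷ vs → label (s E e) ≡ label (t E e)
    same-label′ e∈es (here se≡v)   =
      trans (trans (cong label se≡v) label-v)
            (sym (All.lookup label-fs (∈-filter⁺ (λ e → v ≟ s E e) e∈es (sym se≡v))))
    same-label′ e∈es (there se∈vs) = same-label e∈es se∈vs
    identity₁ : ∀ a b c → b + a + c ≡ a + b + c
    identity₁ = solve-∀
    identity₂ : ∀ a b c d → 1 + a + (b + c) + (1 + d) ≡ 1 + a + (c + b) + (1 + d)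
    identity₂ = solve-∀

  process : ∀ {W} → Unique W → (∀ u → u ∈ W) → ∀ {vs} → TopologicalOrder vs → State W vs
  process {W} unique-W ∈W [] = record
    { ds         = []
    ; roots      = W
    ; label      = λ u → u
    ; M          = λ _ → 0
    ; 1≤ds       = []
    ; unique     = unique-W
    ; label∈     = ∈W
    ; label-root = All.universal (λ _ → refl) W
    ; ΣM≤top     = ≤-reflexive (sum-zeros W)
    ; fresh      = λ _ → refl , refl
    ; count≤M    = λ ()
    ; Σcount≤tot = λ _ → z≤n
    ; same-label = λ _ ()
    ; budget     = refl
    }
    where
    sum-zeros : ∀ (us : List (E⁰ E)) → sum (map (λ _ → 0) us) ≡ 0
    sum-zeros []       = refl
    sum-zeros (_ ∷ us) = sum-zeros us
  process unique-W ∈W (cons v∉vs targets∈vs order) =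
    let σ = process unique-W ∈W order
    in deactivate σ (process-edges _ targets∈vs (activate v∉vs σ))

  topological⇒unique : ∀ {vs} → TopologicalOrder vs → Unique vs
  topological⇒unique []                 = []
  topological⇒unique (cons v∉vs _ order) =
    All.tabulate (λ u∈vs v≡u → v∉vs (subst (_∈ _) (sym v≡u) u∈vs)) ∷ topological⇒unique order

  roots≤1 : ∀ {rs : List (E⁰ E)} → Unique rs → (∀ {q r} → q ∈ rs → r ∈ rs → q ≡ r) → length rs ≤ 1
  roots≤1 []                  _     = z≤n
  roots≤1 (_ ∷ [])            _     = s≤s z≤n
  roots≤1 ((q≢r ∷ _) ∷ _ ∷ _) equal = contradiction (equal (here refl) (there (here refl))) q≢r

  chain-dominates : ∀ {W} → TopologicalOrder W → (∀ u → u ∈ W) → (∀ e → e ∈ es) →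
    (∀ (f : E⁰ E → E⁰ E) → (∀ e → f (s E e) ≡ f (t E e)) → ∀ u v → f u ≡ f v) → outCount W ≤ length es →
    ∃[ ds ] (All (1 ≤_) ds × sum ds ≤ length es × (∀ k → sum (map (walkCount k) W) ≤ tot ds))
  chain-dominates {W} order ∈W ∈es connected outCount≤ with process (topological⇒unique order) ∈W order
  ... | record { ds = ds ; roots = roots ; label = label ; 1≤ds = 1≤ds ; unique = unique ; label-root = label-root
               ; Σcount≤tot = Σcount≤tot ; same-label = same-label ; budget = budget } = strip ds 1≤ds sum≤ Σcount≤tot
    where
    open ≤-Reasoning
    equal : ∀ {q r} → q ∈ roots → r ∈ roots → q ≡ r
    equal {q} {r} q∈ r∈ = trans (sym (All.lookup label-root q∈))
      (trans (connected label (λ e → same-label (∈es e) (∈W (s E e))) q r) (All.lookup label-root r∈))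
    sum≤ : sum ds ≤ 1 + length es
    sum≤ = +-cancelʳ-≤ (length W) _ _ (begin
      sum ds + length W                          ≡⟨ budget ⟩
      length W + outCount W + length roots       ≤⟨ +-mono-≤ (+-monoʳ-≤ (length W) outCount≤) (roots≤1 unique equal) ⟩
      length W + length es + 1                   ≡⟨ identity (length W) (length es) ⟩
      1 + length es + length W                   ∎)
      where
      identity : ∀ a b → a + b + 1 ≡ 1 + b + a
      identity = solve-∀
    strip : ∀ ds → All (1 ≤_) ds → sum ds ≤ 1 + length es → (∀ k → sum (map (walkCount k) W) ≤ tot₀ ds) →
      ∃[ ds ] (All (1 ≤_) ds × sum ds ≤ length es × (∀ k → sum (map (walkCount k) W) ≤ tot ds))
    strip []       _    _    Σ≤ = [] , [] , z≤n , λ k → ≤-trans (Σ≤ k) z≤n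
    strip (_ ∷ _)  1≤ds sum≤ Σ≤ =
      let ds′ , 1≤ds′ , sum′≤ , _ , tot≡ = drop-last 1≤ds
      in ds′ , 1≤ds′ , ≤-pred (≤-trans sum′≤ sum≤) , λ k → ≤-trans (Σ≤ k) (≤-reflexive (sym tot≡))

  outCount≤length : ∀ {W} → Unique W → outCount W ≤ length es
  outCount≤length {W} unique-W = go es
    where
    degree : List (E¹ E) → E⁰ E → ℕ
    degree es v = length (filter (λ e → v ≟ s E e) es)
    unchanged : ∀ e es {vs} → All (s E e ≢_) vs → sum (map (degree (e ∷ es)) vs) ≡ sum (map (degree es) vs)
    unchanged e es se∉vs = cong sum (map-cong-local
      (All.map (λ {v} se≢v → cong length (filter-reject (λ e → v ≟ s E e) (se≢v ∘ sym))) se∉vs))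
    add-edge : ∀ e es {vs} → Unique vs → sum (map (degree (e ∷ es)) vs) ≤ 1 + sum (map (degree es) vs)
    add-edge e es [] = z≤n
    add-edge e es {v ∷ vs} (v∉vs ∷ unique-vs) with v ≟ s E e
    ... | yes refl = s≤s (+-monoʳ-≤ (degree es v) (≤-reflexive (unchanged e es v∉vs)))
    ... | no _     = ≤-trans (+-monoʳ-≤ (degree es v) (add-edge e es unique-vs)) (≤-reflexive (+-suc (degree es v) _))
    go : ∀ es → sum (map (degree es) W) ≤ length es
    go []       = ≤-reflexive (zeros W)
      where
      zeros : ∀ vs → sum (map (degree []) vs) ≡ 0
      zeros []       = refl
      zeros (_ ∷ vs) = zeros vs
    go (e ∷ es) = ≤-trans (add-edge e es unique-W) (s≤s (go es))

  branch : (∀ u → List (Walk E u)) → ∀ v → E¹ E → List (Walk E v)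
  branch continuations v e with v ≟ s E e
  ... | yes v≡se = map (step e v≡se) (continuations (t E e))
  ... | no _     = []

  walks : ℕ → ∀ v → List (Walk E v)
  walks zero    v = stop ∷ []
  walks (suc k) v = stop ∷ concatMap (branch (walks k) v) es

  length-walks : ∀ k v → length (walks k v) ≡ walkCount k v
  length-walks zero    v = refl
  length-walks (suc k) v = cong suc (go es)
    where
    open ≡-Reasoning
    go : ∀ es → length (concatMap (branch (walks k) v) es) ≡ sum (map (λ e → walkCount k (t E e)) (filter (λ e → v ≟ s E e) es))
    go []       = refl
    go (e ∷ es) with v ≟ s E e
    ... | no _     = go es
    ... | yes v≡se = begin
      length (map (step e v≡se) (walks k (t E e)) ++ concatMap (branch (walks k) v) es)          ≡⟨ length-++ (map (step e v≡se) (walks k (t E e))) ⟩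
      length (map (step e v≡se) (walks k (t E e))) + length (concatMap (branch (walks k) v) es)
        ≡⟨ cong₂ _+_ (trans (length-map _ (walks k (t E e))) (length-walks k (t E e))) (go es) ⟩
      walkCount k (t E e) + sum (map (λ e → walkCount k (t E e)) (filter (λ e → v ≟ s E e) es)) ∎

  size : ∀ {v} → Walk E v → ℕ
  size stop         = 0
  size (step _ _ w) = 1 + size w

  ∈-walks : (∀ e → e ∈ es) → ∀ k {v} (w : Walk E v) → size w ≤ k → w ∈ walks k v
  ∈-walks ∈es zero    stop            _          = here refl
  ∈-walks ∈es (suc k) stop            _          = here refl
  ∈-walks ∈es (suc k) (step e refl w) (s≤s |w|≤k) = there (∈-concatMap⁺ (branch (walks k) (s E e)) (lose (∈es e) ∈branch))
    where
    ∈branch : step e refl w ∈ branch (walks k) (s E e) e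
    ∈branch with s E e ≟ s E e
    ... | yes refl  = ∈-map⁺ (step e refl) (∈-walks ∈es k w |w|≤k)
    ... | no se≢se  = contradiction refl se≢se

  walksFrom : ℕ → E⁰ E → List (Σ (E⁰ E) (Walk E))
  walksFrom k v = map (λ w → v , w) (walks k v)

  allWalks : ℕ → List (E⁰ E) → List (Σ (E⁰ E) (Walk E))
  allWalks k = concatMap (walksFrom k)

  length-allWalks : ∀ k vs → length (allWalks k vs) ≡ sum (map (walkCount k) vs)
  length-allWalks k []       = refl
  length-allWalks k (v ∷ vs) = trans (length-++ (walksFrom k v))
    (cong₂ _+_ (trans (length-map tag (walks k v)) (length-walks k v)) (length-allWalks k vs))
    where
    tag : Walk E v → Σ (E⁰ E) (Walk E)
    tag w = v , w

  injection⇒≤ : ∀ {W ds n} → (∀ u → u ∈ W) → (∀ e → e ∈ es) → (∀ k → sum (map (walkCount k) W) ≤ tot ds) →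
    (Fin n ↣ FP E) → n ≤ tot ds
  injection⇒≤ {W} {ds} {n} ∈W ∈es Σ≤ f = begin
    n                          ≤⟨ injective⇒≤ index-injective ⟩
    length (allWalks k W)      ≡⟨ length-allWalks k W ⟩
    sum (map (walkCount k) W)  ≤⟨ Σ≤ k ⟩
    tot ds                     ∎
    where
    open ≤-Reasoning
    walk : Fin n → Σ (E⁰ E) (Walk E)
    walk = Injection.to (↔⇒↣ (FP↔Walks E)) ∘ Injection.to f
    maximum : ∀ {n} (h : Fin n → ℕ) → ∃[ k ] (∀ i → h i ≤ k)
    maximum {zero}  h = 0 , λ ()
    maximum {suc n} h with k , ≤k ← maximum (h ∘ suc) =
      h zero + k , λ { zero → m≤m+n (h zero) k ; (suc i) → ≤-trans (≤k i) (m≤n+m k (h zero)) }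
    k : ℕ
    k = proj₁ (maximum (λ i → size (proj₂ (walk i))))
    walk∈ : ∀ i → walk i ∈ allWalks k W
    walk∈ i = ∈-concatMap⁺ (walksFrom k) (lose (∈W (proj₁ (walk i)))
      (∈-map⁺ (λ w → proj₁ (walk i) , w) (∈-walks ∈es k (proj₂ (walk i)) (proj₂ (maximum (λ i → size (proj₂ (walk i)))) i))))
    index-injective : ∀ {i j} → index (walk∈ i) ≡ index (walk∈ j) → i ≡ j
    index-injective {i} {j} eq = Injection.injective f (Injection.injective (↔⇒↣ (FP↔Walks E))
      (trans (lookup-index (walk∈ i)) (trans (cong (lookup (allWalks k W)) eq) (sym (lookup-index (walk∈ j))))))

  order-vertices : (∀ e → e ∈ es) →
    (∀ (P : E⁰ E → Set) → (∀ v → P v → ∃[ e ] (v ≡ s E e × P (t E e))) → ∀ v → ¬ P v) →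
    ∀ fuel rs → length rs ≤ fuel → ∀ {vs} → TopologicalOrder vs → (∀ u → u ∈ rs ⊎ u ∈ vs) →
    ∃[ W ] (TopologicalOrder W × (∀ u → u ∈ W))
  order-vertices ∈es no-escape fuel [] _ {vs} order cover = vs , order , λ u → [ (λ ()) , (λ u∈vs → u∈vs) ]′ (cover u)
  order-vertices ∈es no-escape (suc fuel) rs@(r ∷ _) |rs|≤ {vs} order cover
    with any? (λ v → all? (λ e → t E e ∈? vs) (out v)) rs
  ... | no ¬ready = contradiction (here refl) (no-escape (_∈ rs) next r)
    where
    next : ∀ v → v ∈ rs → ∃[ e ] (v ≡ s E e × t E e ∈ rs)
    next v v∈rs
      with e , e∈out , te∉vs ← find (¬All⇒Any¬ (λ e → t E e ∈? vs) (out v) (λ ready → ¬ready (lose v∈rs ready)))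
      = e , proj₂ (∈-filter⁻ (λ e → v ≟ s E e) {xs = es} e∈out)
      , [ (λ te∈rs → te∈rs) , (λ te∈vs → contradiction te∈vs te∉vs) ]′ (cover (t E e))
  ... | yes ready with v , v∈rs , targets∈vs ← find ready with rest , rs↭ ← ∈⇒↭ v∈rs with v ∈? vs
  ...   | yes v∈vs = order-vertices ∈es no-escape fuel rest
            (≤-pred (≤-trans (≤-reflexive (sym (↭-length rs↭))) |rs|≤)) order cover′
    where
    cover′ : ∀ u → u ∈ rest ⊎ u ∈ vs
    cover′ u with cover u
    ... | inj₂ u∈vs = inj₂ u∈vs
    ... | inj₁ u∈rs with ∈-resp-↭ rs↭ u∈rs
    ...   | here refl    = inj₂ v∈vs
    ...   | there u∈rest = inj₁ u∈rest
  ...   | no v∉vs = order-vertices ∈es no-escape fuel rest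
            (≤-pred (≤-trans (≤-reflexive (sym (↭-length rs↭))) |rs|≤)) (cons v∉vs targets∈vs order) cover′
    where
    cover′ : ∀ u → u ∈ rest ⊎ u ∈ v ∷ vs
    cover′ u with cover u
    ... | inj₂ u∈vs = inj₂ (there u∈vs)
    ... | inj₁ u∈rs with ∈-resp-↭ rs↭ u∈rs
    ...   | here u≡v     = inj₂ (here u≡v)
    ...   | there u∈rest = inj₁ u∈rest

  paths≤ : ∀ {P} → (∀ e → e ∈ es) →
    (∀ (f : E⁰ E → E⁰ E) → (∀ e → f (s E e) ≡ f (t E e)) → ∀ u v → f u ≡ f v) →
    (∀ {ds} → All (1 ≤_) ds → sum ds ≤ length es → tot ds ≤ P) →
    ∃[ W ] (TopologicalOrder W × (∀ u → u ∈ W)) → ∀ n → (Fin n ↣ FP E) → n ≤ P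
  paths≤ ∈es constant tot≤P (W , order , ∈W) n f =
    let ds , 1≤ds , sum≤ , Σ≤ = chain-dominates order ∈W ∈es constant (outCount≤length (topological⇒unique order))
    in ≤-trans (injection⇒≤ {ds = ds} ∈W ∈es Σ≤ f) (tot≤P 1≤ds sum≤)

no-infinite-walk : ∀ {E N} → Acyclic E → HasEdgeCount E N →
  (P : E⁰ E → Set) → (∀ v → P v → ∃[ e ] (v ≡ s E e × P (t E e))) → ∀ v → ¬ P v
no-infinite-walk {E} {N} acyclic E¹↔FinN P next v₀ Pv₀ = acyclic (edge i ∷ segment i m , linked i m) (begin
  s E (edge i)                            ≡⟨ cong (s E) edge-repeats ⟩
  s E (edge (1 + i + m))                  ≡⟨ cong (λ n → s E (edge (1 + n))) (+-comm i m) ⟩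
  s E (edge (1 + m + i))                  ≡⟨ sym (consecutive (m + i)) ⟩
  t E (edge (m + i))                      ≡⟨ cong (t E) (sym (last-segment i m)) ⟩
  t E (last (edge i ∷ segment i m))       ∎)
  where
  open ≡-Reasoning
  σ : ℕ → Σ[ e ∈ E¹ E ] P (t E e)
  σ zero    with e , _ , Pte ← next v₀ Pv₀ = e , Pte
  σ (suc n) with e , _ , Pte ← next _ (proj₂ (σ n)) = e , Pte
  edge : ℕ → E¹ E
  edge n = proj₁ (σ n)
  consecutive : ∀ n → t E (edge n) ≡ s E (edge (suc n))
  consecutive n = proj₁ (proj₂ (next _ (proj₂ (σ n))))
  segment : ℕ → ℕ → List (E¹ E)
  segment i zero    = []
  segment i (suc m) = edge (suc i) ∷ segment (suc i) m
  linked : ∀ i m → Linked (λ e f → t E e ≡ s E f) (edge i ∷ segment i m)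
  linked i zero    = [-]
  linked i (suc m) = consecutive i ∷ linked (suc i) m
  last-segment : ∀ i m → last (edge i ∷ segment i m) ≡ edge (m + i)
  last-segment i zero    = refl
  last-segment i (suc m) = trans (last-∷ (edge i) (edge (suc i)) (segment (suc i) m))
    (trans (last-segment (suc i) m) (cong edge (+-suc m i)))
  repeat : ∃[ i ] ∃[ j ] (i < j × edge i ≡ edge j)
  repeat with i , j , i<j , eq ← pigeonhole (n<1+n N) (λ i → Injection.to (↔⇒↣ E¹↔FinN) (edge (toℕ i)))
    = toℕ i , toℕ j , i<j , Injection.injective (↔⇒↣ E¹↔FinN) eq
  i m : ℕ
  i = proj₁ repeat
  m = proj₁ (m≤n⇒∃[o]m+o≡n (proj₁ (proj₂ (proj₂ repeat))))
  edge-repeats : edge i ≡ edge (1 + i + m)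
  edge-repeats = trans (proj₂ (proj₂ (proj₂ repeat)))
    (cong edge (sym (proj₂ (m≤n⇒∃[o]m+o≡n (proj₁ (proj₂ (proj₂ repeat)))))))

connected⇒constant : ∀ {E} → Connected E → {A : Set} (f : E⁰ E → A) → (∀ e → f (s E e) ≡ f (t E e)) → ∀ u v → f u ≡ f v
connected⇒constant connected f f-edge u v =
  EqClosure.gfold isEquivalence f (λ { (e , refl , refl) → f-edge e }) (connected u v)

-- Equality of vertices need not be decidable, but the inequality to be proved is stable under double negation.
¬¬-All : ∀ {A : Set} {P : A → Set} → (∀ x → ¬ ¬ P x) → ∀ xs → ¬ ¬ All P xs
¬¬-All ¬¬P []       k = k []
¬¬-All ¬¬P (x ∷ xs) k = ¬¬P x (λ p → ¬¬-All ¬¬P xs (λ ps → k (p ∷ ps)))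

finite⇒¬¬-decidable : ∀ {A : Set} (xs : List A) → (∀ x → x ∈ xs) → ¬ ¬ DecidableEquality A
finite⇒¬¬-decidable xs ∈xs k =
  ¬¬-All (λ x → ¬¬-All (λ y → ¬¬-excluded-middle) xs) xs
    (λ decide → k (λ x y → All.lookup (All.lookup decide (∈xs x)) (∈xs y)))

edgeList : ∀ {E N} → HasEdgeCount E N → List (E¹ E)
edgeList E¹↔FinN = tabulate (Inverse.from E¹↔FinN)

∈-edgeList : ∀ {E N} (E¹↔FinN : HasEdgeCount E N) e → e ∈ edgeList {E} E¹↔FinN
∈-edgeList E¹↔FinN e = subst (_∈ _) (Inverse.strictlyInverseʳ E¹↔FinN e) (∈-tabulate⁺ (Inverse.to E¹↔FinN e))

vertexList : ∀ {E} → List (E¹ E) → List (E⁰ E)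
vertexList {E} = concatMap (λ e → s E e ∷ t E e ∷ [])

∈-vertexList : ∀ {E es} → Connected E → (∀ e → e ∈ es) → E¹ E → ∀ v → v ∈ vertexList {E} es
∈-vertexList {E} {es} connected ∈es e₀ v with connected v (s E e₀)
... | ε                       = ∈-concatMap⁺ _ (lose (∈es e₀) (here refl))
... | fwd (e , refl , _) ◅ _  = ∈-concatMap⁺ _ (lose (∈es e) (here refl))
... | bwd (e , _ , refl) ◅ _  = ∈-concatMap⁺ _ (lose (∈es e) (there (here refl)))

paths≤chain : ∀ {E N} → 1 ≤ N → Connected E → Acyclic E → HasEdgeCount E N → ∀ {P} →
  (∀ {ds} → All (1 ≤_) ds → sum ds ≤ N → tot ds ≤ P) → ∀ n → (Fin n ↣ FP E) → n ≤ P
paths≤chain {E} {N@(suc _)} _ connected acyclic E¹↔FinN {P} tot≤P n f = decidable-stable (n ≤? P) λ n≰P →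
  finite⇒¬¬-decidable vertices ∈vertices (λ _≟_ → n≰P (bound _≟_))
  where
  es : List (E¹ E)
  es = edgeList {E} E¹↔FinN
  ∈es : ∀ e → e ∈ es
  ∈es = ∈-edgeList {E} E¹↔FinN
  vertices : List (E⁰ E)
  vertices = vertexList {E} es
  ∈vertices : ∀ v → v ∈ vertices
  ∈vertices = ∈-vertexList {E} connected ∈es (Inverse.from E¹↔FinN zero)
  bound : DecidableEquality (E⁰ E) → n ≤ P
  bound _≟_ =
    paths≤ ∈es (λ f → connected⇒constant {E} connected f)
      (λ 1≤ds sum≤ → tot≤P 1≤ds (≤-trans sum≤ (≤-reflexive (length-tabulate (Inverse.from E¹↔FinN)))))
      (order-vertices ∈es (no-infinite-walk {E} acyclic E¹↔FinN) (length vertices) vertices ≤-refl [] (inj₁ ∘ ∈vertices))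
      n f
    where open Bound E _≟_ es

baseEdgeCount≡ : ∀ i → baseEdgeCount i ≡ 3 * baseQuotient i + toℕ i
baseEdgeCount≡ 0F = refl
baseEdgeCount≡ 1F = refl
baseEdgeCount≡ 2F = refl

baseQuotient≤ : ∀ {k} i → 16 ≤ 3 * k + toℕ i → baseQuotient i ≤ k
baseQuotient≤ {k} i 16≤ with baseQuotient i ≤? k
... | yes q≤k = q≤k
... | no  q≰k = contradiction 16≤ (<⇒≱ (≤-trans (s≤s (+-monoˡ-≤ (toℕ i) (*-monoʳ-≤ 3 (suc[m]≤n⇒m≤pred[n] (≰⇒> q≰k))))) (small i)))
  where
  small : ∀ i → 3 * (baseQuotient i ∸ 1) + toℕ i < 16
  small 0F = ≤ᵇ⇒≤ _ _ tt
  small 1F = ≤ᵇ⇒≤ _ _ tt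
  small 2F = ≤ᵇ⇒≤ _ _ tt

isMaximal : ∀ j i → IsMaximalPathCount (baseEdgeCount i + 3 * j) (maxTot j i)
isMaximal j i = record
  { attained = chain ds , chain-connected (extremal≥1 j i) , chain-acyclic ds
             , subst (HasEdgeCount (chain ds)) (sum-extremal j i) (chain-edges ds)
             , subst (λ P → FP (chain ds) ↔ Fin P) (tot-extremal j i) (chain-paths ds)
  ; bound    = λ E connected acyclic edges →
      paths≤chain {E} {baseEdgeCount i + 3 * j} (1≤edges i) connected acyclic edges {maxTot j i} (tot≤maxTot j i)
  }
  where
  ds : List ℕ
  ds = extremal j i
  1≤edges : ∀ i → 1 ≤ baseEdgeCount i + 3 * j
  1≤edges 0F = s≤s z≤n
  1≤edges 1F = s≤s z≤n
  1≤edges 2F = s≤s z≤n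

theorem3p15 : ∀ (N k : ℕ) (i : Fin 3) → N ≥ 16 → N ≡ 3 * k + toℕ i →
    ∃[ P ] (IsMaximalPathCount N P × (+ P) / 1 ≡ pathCountFormula k i)
theorem3p15 N k i N≥16 N≡ = maxTot j i
  , subst (λ n → IsMaximalPathCount n (maxTot j i)) (sym N≡base) (isMaximal j i)
  , trans (maxTot-formula j i) (cong (λ k → pathCountFormula k i) q+j≡k)
  where
  q≤k : baseQuotient i ≤ k
  q≤k = baseQuotient≤ i (subst (16 ≤_) N≡ N≥16)
  j : ℕ
  j = k ∸ baseQuotient i
  q+j≡k : baseQuotient i + j ≡ k
  q+j≡k = m+[n∸m]≡n q≤k
  identity : ∀ q j r → 3 * (q + j) + r ≡ 3 * q + r + 3 * j
  identity = solve-∀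
  N≡base : N ≡ baseEdgeCount i + 3 * j
  N≡base = trans N≡ (trans (cong (λ k → 3 * k + toℕ i) (sym q+j≡k))
    (trans (identity (baseQuotient i) j (toℕ i)) (cong (λ n → n + 3 * j) (sym (baseEdgeCount≡ i)))))
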